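{- Let $T$ be a standard Young tableau of shape $\lambda\vdash k$. Then for $n\ge k$, the number of standard Young tableaux with $n$ cells (of any shape) that contain $T$ as a subtableau, i.e., in which the cells with entries $1,\ldots,k$ form exactly $T$, equals $$\sum_{j=0}^{k}\sum_{\mu\vdash j}f^{\lambda/\mu}\binom{n-k}{k-j}t_{n-2k+j}.$$
   Context: $f^{\lambda/\mu}$ is the number of standard Young tableaux of skew shape $\lambda/\mu$ (zero if $\mu\not\subseteq\lambda$), with $f^{\lambda/\emptyset}=f^\lambda$. $t_m$ denotes the number of involutions in $\mathcal{S}_m$ ($t_0=1$), and terms with $k-j>n-k$ are $0$. -}

module Defs where

open import Algebra.Definitions using (Involutive)
open import Data.Bool using (if_then_else_)
open import Data.Fin using (Fin; toℕ)
import Data.Fin.Properties as Fin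
open import Data.List using (List; []; _∷_; length; map; upTo; concatMap; filter; cartesianProductWith; allFin)
open import Data.Nat.ListAction using (sum)
import Data.List as List
open import Data.List.Relation.Unary.All using (All; all?)
open import Data.List.Relation.Unary.Linked using (Linked; linked?)
open import Data.Nat using (ℕ; zero; suc; _+_; _∸_; _≤_; _<_; _≥_; _≟_; _≤?_; _<?_; _≥?_)
open import Data.Product using (_×_; _,_; proj₁; proj₂; ∃)
open import Data.Product.Properties using (≡-dec)
open import Data.Vec using (Vec; []; _∷_; lookup)
open import Data.Vec.Relation.Unary.Unique.Propositional using (Unique)
open import Data.Vec.Relation.Unary.AllPairs using (allPairs?)
open import Relation.Binary.Definitions using (DecidableEquality)
open import Relation.Binary.PropositionalEquality using (_≡_)
open import Relation.Nullary using (Dec; does; ¬?)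
open import Relation.Nullary.Decidable using (_×-dec_; _→-dec_)
open import Relation.Unary using (Decidable)

vectors : ∀ {A : Set} → List A → (n : ℕ) → List (Vec A n)
vectors xs zero    = [] ∷ []
vectors xs (suc n) = cartesianProductWith _∷_ xs (vectors xs n)

listsUpTo : ∀ {A : Set} → List A → (n : ℕ) → List (List A)
listsUpTo xs zero    = [] ∷ []
listsUpTo xs (suc n) = [] ∷ cartesianProductWith _∷_ xs (listsUpTo xs n)

count : ∀ {A : Set} {P : A → Set} → Decidable P → List A → ℕ
count P? xs = length (filter P? xs)

IsPartition : ℕ → List ℕ → Set
IsPartition n lam = Linked _≥_ lam × All (0 <_) lam × sum lam ≡ n

isPartition? : ∀ n → Decidable (IsPartition n)
isPartition? n lam = linked? _≥?_ lam ×-dec all? (0 <?_) lam ×-dec sum lam ≟ n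

-- A partition of n has at most n parts, each of them at most n.
partitions : ℕ → List (List ℕ)
partitions n = filter (isPartition? n) (listsUpTo (upTo (suc n)) n)

part : List ℕ → ℕ → ℕ
part []        _       = 0
part (x ∷ lam) zero    = x
part (x ∷ lam) (suc i) = part lam i

_⊆_ : List ℕ → List ℕ → Set
mu ⊆ lam = ∀ (i : Fin (length mu)) → List.lookup mu i ≤ part lam (toℕ i)

_⊆?_ : ∀ mu lam → Dec (mu ⊆ lam)
mu ⊆? lam = Fin.all? λ i → List.lookup mu i ≤? part lam (toℕ i)

-- (row , column), both counted from 0.
Cell : Set
Cell = ℕ × ℕ

_≟ᶜ_ : DecidableEquality Cell
_≟ᶜ_ = ≡-dec _≟_ _≟_

-- The cells (i , j) with part mu i ≤ j < part lam i.
cells : List ℕ → List ℕ → List Cell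
cells lam mu =
  concatMap (λ i → map (λ d → i , part mu i + d) (upTo (part lam i ∸ part mu i)))
            (upTo (length lam))

size : List ℕ → List ℕ → ℕ
size lam mu = length (cells lam mu)

cell : ∀ lam mu → Fin (size lam mu) → Cell
cell lam mu = List.lookup (cells lam mu)

row col : ∀ lam mu → Fin (size lam mu) → ℕ
row lam mu a = proj₁ (cell lam mu a)
col lam mu a = proj₂ (cell lam mu a)

-- A filling of lam/mu assigns to each cell, addressed by its position in
-- `cells lam mu`, one of as many values as there are cells; the element v of
-- Fin stands for the entry toℕ v + 1, so that the entries are 1, …, |lam/mu|.
Filling : List ℕ → List ℕ → Set
Filling lam mu = Vec (Fin (size lam mu)) (size lam mu)

fillings : ∀ lam mu → List (Filling lam mu)
fillings lam mu = vectors (allFin (size lam mu)) (size lam mu)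

entry : ∀ {m n} → Vec (Fin m) n → Fin n → ℕ
entry U a = suc (toℕ (lookup U a))

RowsIncrease ColumnsIncrease : ∀ lam mu → Filling lam mu → Set
RowsIncrease lam mu U = ∀ a b →
  row lam mu a ≡ row lam mu b → col lam mu a < col lam mu b → entry U a < entry U b
ColumnsIncrease lam mu U = ∀ a b →
  col lam mu a ≡ col lam mu b → row lam mu a < row lam mu b → entry U a < entry U b

-- There are as many cells as values, so `Unique` says that every one of
-- 1, …, |lam/mu| is used exactly once.
IsStandard : ∀ lam mu → Filling lam mu → Set
IsStandard lam mu U = Unique U × RowsIncrease lam mu U × ColumnsIncrease lam mu U

isStandard? : ∀ lam mu → Decidable (IsStandard lam mu)
isStandard? lam mu U =
  allPairs? (λ x y → ¬? (x Fin.≟ y)) U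
  ×-dec (Fin.all? λ a → Fin.all? λ b →
    row lam mu a ≟ row lam mu b →-dec col lam mu a <? col lam mu b →-dec entry U a <? entry U b)
  ×-dec (Fin.all? λ a → Fin.all? λ b →
    col lam mu a ≟ col lam mu b →-dec row lam mu a <? row lam mu b →-dec entry U a <? entry U b)

-- The number f^{lam/mu} of standard Young tableaux of shape lam/mu.
f : List ℕ → List ℕ → ℕ
f lam mu = if does (mu ⊆? lam) then count (isStandard? lam mu) (fillings lam mu) else 0

-- The cells of U with entries 1, …, k, together with these entries, are exactly
-- the cells of T with their entries (T is meant to have k cells).
Contains : ∀ k lam nu → Filling lam [] → Filling nu [] → Set
Contains k lam nu T U =
  (∀ a → ∃ λ b → cell nu [] b ≡ cell lam [] a × entry U b ≡ entry T a) ×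
  (∀ b → entry U b ≤ k → ∃ λ a → cell lam [] a ≡ cell nu [] b × entry T a ≡ entry U b)

contains? : ∀ k lam nu T → Decidable (Contains k lam nu T)
contains? k lam nu T U =
  (Fin.all? λ a → Fin.any? λ b →
    cell nu [] b ≟ᶜ cell lam [] a ×-dec entry U b ≟ entry T a)
  ×-dec (Fin.all? λ b → entry U b ≤? k →-dec Fin.any? λ a →
    cell lam [] a ≟ᶜ cell nu [] b ×-dec entry T a ≟ entry U b)

-- The number of standard Young tableaux with n cells containing T.
extensions : (k n : ℕ) (lam : List ℕ) → Filling lam [] → ℕ
extensions k n lam T = sum (map (λ nu →
  count (λ U → isStandard? nu [] U ×-dec contains? k lam nu T U) (fillings nu []))
  (partitions n))

-- Maps from an m-element set to itself are given by their value vectors; one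
-- that squares to the identity is automatically a permutation.
IsInvolution : ∀ {m} → Vec (Fin m) m → Set
IsInvolution π = Involutive _≡_ (lookup π)

isInvolution? : ∀ {m} → Decidable (IsInvolution {m})
isInvolution? π = Fin.all? λ i → lookup π (lookup π i) Fin.≟ i

-- The number t_m of involutions in the symmetric group S_m, the identity included.
t : ℕ → ℕ
t m = count isInvolution? (vectors (allFin m) m)

{-# OPTIONS --safe #-}
-- In Young's lattice the operators U and D of adding and removing a cell satisfy DU − UD = 1.
-- Hence, if d(i, λ) denotes the number of ways of removing i cells from λ one at a time, the
-- values of d(i, ·) at the upper neighbours of λ sum up to d(i+1, λ) + d(i, λ) + i d(i−1, λ).
-- With t(m+2) = t(m+1) + (m+1) t(m) it follows by induction on m that there are
-- Σ_i C(m, i) t(m−i) d(i, λ) ways of adding m cells to λ one at a time. Reading a standard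
-- tableau in the order of its entries as a walk in Young's lattice identifies the tableaux
-- extending T with the walks of n−k steps up from λ, and the standard tableaux of the shapes
-- λ/μ with |μ| = j with the walks of k−j steps down from λ.

module Submission where

open import Defs
open import Data.Bool using (if_then_else_)
open import Data.Fin using (Fin; zero; suc; punchIn; punchOut; toℕ; fromℕ<)
import Data.Fin.Properties as Fin
open import Data.List using (List; []; _∷_; _++_; length; map; filter; concatMap; allFin; cartesianProductWith; cartesianProduct; _∷ʳ_; upTo; applyUpTo; initLast; _∷ʳ′_)
import Data.List as List
open import Data.List.Membership.Propositional using (_∈_; find; lose)
open import Data.List.Membership.Propositional.Properties
open import Data.List.Properties using (length-map; length-++; length-removeAt′; length-tabulate; map-upTo; ∷ʳ-injective; ∷-injective; ++-identityʳ; ++-cancelˡ; map-cong)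
open import Data.List.Relation.Unary.All using (All; []; _∷_)
import Data.List.Relation.Unary.All as All
open import Data.List.Relation.Unary.AllPairs using ([]; _∷_; AllPairs)
import Data.List.Relation.Unary.AllPairs as AllPairs
open import Data.List.Relation.Unary.Any using (here; there; index; _─_)
import Data.List.Relation.Unary.Any as Any
import Data.List.Relation.Unary.Any.Properties as Any
open import Data.List.Relation.Unary.Linked using (Linked; []; [-]; _∷_)
import Data.List.Relation.Unary.Unique.Propositional as List
import Data.List.Relation.Unary.Unique.Propositional.Properties as Unique
open import Data.Nat using (ℕ; zero; suc; pred; _+_; _*_; _∸_; _≤_; _<_; z≤n; s≤s; _≟_; _<?_; _≥_)
open import Data.Nat.Combinatorics using (_C_; nC1≡n; nCk+nC[k+1]≡[n+1]C[k+1]; k>n⇒nCk≡0)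
open import Data.Nat.ListAction using (sum)
open import Data.Nat.Properties
open import Data.Nat.Tactic.RingSolver using (solve-∀)
open import Data.Product using (_×_; _,_; proj₁; proj₂; ∃; Σ)
open import Data.Sum using (_⊎_; inj₁; inj₂)
open import Data.Sum.Properties using (inj₁-injective; inj₂-injective)
open import Data.Unit using (⊤; tt)
open import Data.Vec using (Vec; []; _∷_; lookup; tabulate)
open import Data.Vec.Properties using (lookup∘tabulate; tabulate∘lookup)
import Data.Vec.Properties as Vec
import Data.Vec.Relation.Unary.Unique.Propositional as Vec
import Data.Vec.Relation.Unary.Unique.Propositional.Properties as VecUnique
open import Function using (_∘_)
open import Relation.Binary.Definitions using (tri<; tri≈; tri>)
open import Relation.Binary.PropositionalEquality using (_≡_; _≢_; _≗_; refl; sym; trans; cong; cong₂; subst; subst₂; module ≡-Reasoning)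
open import Relation.Nullary using (Dec; yes; no; does; ¬_; contradiction)
open import Relation.Nullary.Decidable using (_×-dec_)
open import Relation.Unary using (Decidable)

-- Finite sums

-- Two obstacles shape the formalization. Shapes are functions from rows to row lengths, so
-- equalities between them hold only pointwise, and the infinitely many rows have to be cut off at a
-- bound `N`. The commutation relation is proved under the condition that the last row in range is
-- empty, since otherwise an addable row could lie just outside; hence the bounds carried along with
-- every shape. Tableaux, on the other hand, are vectors whose very type depends on the shape, which
-- makes tableaux of different shapes awkward to compare. Both kinds are therefore matched with a
-- common object free of indices, the list of their cells in the order of the entries. Once one end
-- of a walk is fixed this list determines the other end, so it stands for shape and filling
-- together. In the final formula i = k - j is the number of removed cells: the binomial cuts the
-- sum over i off at n - k, and the size of λ cuts it off at k.

⟦_⟧ : {P : Set} → Dec P → ℕ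
⟦ yes _ ⟧ = 1
⟦ no  _ ⟧ = 0

⟦⟧-cong : {P Q : Set} (p : Dec P) (q : Dec Q) → (P → Q) → (Q → P) → ⟦ p ⟧ ≡ ⟦ q ⟧
⟦⟧-cong (yes _) (yes _) _ _ = refl
⟦⟧-cong (yes x) (no ¬y) f _ = contradiction (f x) ¬y
⟦⟧-cong (no ¬x) (yes y) _ g = contradiction (g y) ¬x
⟦⟧-cong (no _)  (no _)  _ _ = refl

⟦⟧-*-cong : {P : Set} (p : Dec P) {x y : ℕ} → (P → x ≡ y) → ⟦ p ⟧ * x ≡ ⟦ p ⟧ * y
⟦⟧-*-cong (yes p) eq = cong (_+ 0) (eq p)
⟦⟧-*-cong (no _)  _  = refl

choose : {P : Set} → Dec P → ℕ → ℕ → ℕ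
choose (yes _) x y = x
choose (no  _) x y = y

-- Opaque, for F cannot be inferred once ∑ (suc n) F unfolds.
opaque
  ∑ : ℕ → (ℕ → ℕ) → ℕ
  ∑ zero    F = 0
  ∑ (suc n) F = F 0 + ∑ n (F ∘ suc)

  ∑-cong< : ∀ n {F G : ℕ → ℕ} → (∀ i → i < n → F i ≡ G i) → ∑ n F ≡ ∑ n G
  ∑-cong< zero    _  = refl
  ∑-cong< (suc n) eq = cong₂ _+_ (eq 0 (s≤s z≤n)) (∑-cong< n λ i i<n → eq (suc i) (s≤s i<n))

  ∑-cong : ∀ n {F G : ℕ → ℕ} → F ≗ G → ∑ n F ≡ ∑ n G
  ∑-cong n eq = ∑-cong< n λ i _ → eq i

  ∑-last : ∀ n F → ∑ (suc n) F ≡ ∑ n F + F n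
  ∑-last zero    F = +-comm (F 0) 0
  ∑-last (suc n) F = trans (cong (F 0 +_) (∑-last n (F ∘ suc))) (sym (+-assoc (F 0) _ _))

  ∑-zero : ∀ n F → (∀ i → F i ≡ 0) → ∑ n F ≡ 0
  ∑-zero zero    F eq = refl
  ∑-zero (suc n) F eq = cong₂ _+_ (eq 0) (∑-zero n (F ∘ suc) (eq ∘ suc))

  ∑-+ : ∀ n F G → ∑ n (λ i → F i + G i) ≡ ∑ n F + ∑ n G
  ∑-+ zero    F G = refl
  ∑-+ (suc n) F G = trans (cong (F 0 + G 0 +_) (∑-+ n (F ∘ suc) (G ∘ suc)))
    (interchange (F 0) (G 0) _ _)
    where
    interchange : ∀ a b c d → a + b + (c + d) ≡ a + c + (b + d)
    interchange = solve-∀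

  ∑-*ˡ : ∀ n c F → ∑ n (λ i → c * F i) ≡ c * ∑ n F
  ∑-*ˡ zero    c F = sym (*-zeroʳ c)
  ∑-*ˡ (suc n) c F = trans (cong (c * F 0 +_) (∑-*ˡ n c (F ∘ suc))) (sym (*-distribˡ-+ c (F 0) _))

  ∑-*ʳ : ∀ n c F → ∑ n (λ i → F i * c) ≡ ∑ n F * c
  ∑-*ʳ n c F = trans (∑-cong n λ i → *-comm (F i) c) (trans (∑-*ˡ n c F) (*-comm c _))

  ∑-swap : ∀ m n (F : ℕ → ℕ → ℕ) → ∑ m (λ i → ∑ n (F i)) ≡ ∑ n (λ j → ∑ m λ i → F i j)
  ∑-swap zero    n F = sym (∑-zero n _ λ _ → refl)
  ∑-swap (suc m) n F = trans (cong (∑ n (F 0) +_) (∑-swap m n (F ∘ suc)))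
    (sym (∑-+ n (F 0) _))

  ∑-empty : ∀ F → ∑ 0 F ≡ 0
  ∑-empty F = refl

  ∑-suc : ∀ n F → ∑ (suc n) F ≡ F 0 + ∑ n (F ∘ suc)
  ∑-suc n F = refl

∑-reverse : ∀ n F → ∑ (suc n) (λ j → F (n ∸ j)) ≡ ∑ (suc n) F
∑-reverse zero    F = ∑-cong< 1 λ { zero _ → refl ; (suc i) (s≤s ()) }
∑-reverse (suc n) F = begin
  ∑ (suc (suc n)) (λ j → F (suc n ∸ j))   ≡⟨ ∑-suc (suc n) _ ⟩
  F (suc n) + ∑ (suc n) (λ j → F (n ∸ j)) ≡⟨ cong (F (suc n) +_) (∑-reverse n F) ⟩
  F (suc n) + ∑ (suc n) F                 ≡⟨ +-comm (F (suc n)) _ ⟩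
  ∑ (suc n) F + F (suc n)                 ≡⟨ ∑-last (suc n) F ⟨
  ∑ (suc (suc n)) F                       ∎
  where open ≡-Reasoning

∑-extend : ∀ m n F → (∀ i → m ≤ i → F i ≡ 0) → ∑ (n + m) F ≡ ∑ m F
∑-extend m zero    F eq = refl
∑-extend m (suc n) F eq = begin
  ∑ (suc (n + m)) F         ≡⟨ ∑-last (n + m) F ⟩
  ∑ (n + m) F + F (n + m)   ≡⟨ cong₂ _+_ (∑-extend m n F eq) (eq (n + m) (m≤n+m m n)) ⟩
  ∑ m F + 0                 ≡⟨ +-identityʳ _ ⟩
  ∑ m F                     ∎
  where open ≡-Reasoning

∑-delta : ∀ n i x → i < n → ∑ n (λ j → ⟦ i ≟ j ⟧ * x) ≡ x
∑-delta (suc n) zero    x _         = trans (∑-suc n _)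
  (trans (cong (x + 0 +_) (∑-zero n _ λ _ → refl)) (trans (+-identityʳ _) (+-identityʳ _)))
∑-delta (suc n) (suc i) x (s≤s i<n) = trans (∑-suc n _) (trans
  (∑-cong n λ j → cong (_* x) (⟦⟧-cong (suc i ≟ suc j) (i ≟ j) suc-injective (cong suc))) (∑-delta n i x i<n))

-- A partition is handled through the function giving its row lengths.
Shape : Set
Shape = ℕ → ℕ

-- Adding and removing cells of shapes.

Decreasing : Shape → Set
Decreasing g = ∀ i → g (suc i) ≤ g i

-- A cell fits at the end of row i + 1 exactly if row i is strictly longer, which is also the
-- condition for removing the last cell of row i. Making the two definitionally equal reduces the
-- comparison of their numbers to an index shift, and lets `addable-resp` serve for both.
Addable Removable : Shape → ℕ → Set
Removable g i = g (suc i) < g i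
Addable g zero    = ⊤
Addable g (suc i) = Removable g i

removable? : ∀ g i → Dec (Removable g i)
removable? g i = g (suc i) <? g i

addable? : ∀ g i → Dec (Addable g i)
addable? g zero    = yes tt
addable? g (suc i) = removable? g i

inc dec : Shape → ℕ → Shape
inc g i r = choose (r ≟ i) (suc (g r)) (g r)
dec g i r = choose (r ≟ i) (pred (g r)) (g r)

inc-same : ∀ g i → inc g i i ≡ suc (g i)
inc-same g i with i ≟ i
... | yes _   = refl
... | no  i≢i = contradiction refl i≢i

inc-other : ∀ g {i r} → r ≢ i → inc g i r ≡ g r
inc-other g {i} {r} r≢i with r ≟ i
... | yes r≡i = contradiction r≡i r≢i
... | no  _   = refl

dec-same : ∀ g i → dec g i i ≡ pred (g i)
dec-same g i with i ≟ i
... | yes _   = refl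
... | no  i≢i = contradiction refl i≢i

dec-other : ∀ g {i r} → r ≢ i → dec g i r ≡ g r
dec-other g {i} {r} r≢i with r ≟ i
... | yes r≡i = contradiction r≡i r≢i
... | no  _   = refl

inc-cong : ∀ {g h} i → g ≗ h → inc g i ≗ inc h i
inc-cong i eq r with r ≟ i
... | yes _ = cong suc (eq r)
... | no  _ = eq r

dec-cong : ∀ {g h} i → g ≗ h → dec g i ≗ dec h i
dec-cong i eq r with r ≟ i
... | yes _ = cong pred (eq r)
... | no  _ = eq r

dec-inc : ∀ g i → dec (inc g i) i ≗ g
dec-inc g i r with r ≟ i
... | yes _ = refl
... | no  _ = refl

suc-pred-pos : ∀ {n} → 0 < n → suc (pred n) ≡ n
suc-pred-pos (s≤s _) = refl

inc-dec : ∀ g i → 0 < g i → inc (dec g i) i ≗ g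
inc-dec g i 0<gi r with r ≟ i
... | yes refl = suc-pred-pos 0<gi
... | no  _ = refl

dec-inc-comm : ∀ g {i j} → i ≢ j → dec (inc g i) j ≗ inc (dec g j) i
dec-inc-comm g {i} {j} i≢j r with r ≟ i | r ≟ j
... | yes refl | yes refl = contradiction refl i≢j
... | yes _    | no  _    = refl
... | no  _    | yes _    = refl
... | no  _    | no  _    = refl

inc-≥ : ∀ g i r → g r ≤ inc g i r
inc-≥ g i r with r ≟ i
... | yes _ = n≤1+n (g r)
... | no  _ = ≤-refl

dec-≤ : ∀ g i r → dec g i r ≤ g r
dec-≤ g i r with r ≟ i
... | yes _ = pred[n]≤n
... | no  _ = ≤-refl

inc-decreasing : ∀ {g} i → Addable g i → Decreasing g → Decreasing (inc g i)
inc-decreasing {g} i add g↓ r with suc r ≟ i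
... | yes refl = ≤-trans add (inc-≥ g i r)
... | no  _    = ≤-trans (g↓ r) (inc-≥ g i r)

dec-decreasing : ∀ {g} i → Removable g i → Decreasing g → Decreasing (dec g i)
dec-decreasing {g} i rem g↓ r with r ≟ i
... | yes refl = ≤-trans (dec-≤ g i (suc r)) (pred-mono-≤ rem)
... | no  _    = ≤-trans (dec-≤ g i (suc r)) (g↓ r)

addable-resp : ∀ {g h} i → g ≗ h → Addable g i → Addable h i
addable-resp zero    _  _   = tt
addable-resp (suc i) eq add = subst (_< _) (eq (suc i)) (subst (_ <_) (eq i) add)

removable-inc : ∀ {g} i → Decreasing g → Removable (inc g i) i
removable-inc {g} i g↓ = subst (inc g i (suc i) <_) (sym (inc-same g i))
  (subst (_< suc (g i)) (sym (inc-other g λ ())) (s≤s (g↓ i)))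

addable-dec : ∀ {g} i → Decreasing g → Removable g i → Addable (dec g i) i
addable-dec zero    _  _   = tt
addable-dec {g} (suc i) g↓ rem = subst₂ _≤_
  (trans (sym (suc-pred-pos (≤-<-trans z≤n rem))) (cong suc (sym (dec-same g (suc i)))))
  (sym (dec-other g λ ())) (g↓ i)

module _ {g : Shape} {i j : ℕ} (i≢j : i ≢ j) where

  -- The two moves interact only if row `j` lies directly above row `i`. In that case either order
  -- of the moves requires row `j` to exceed row `i` by at least two cells. The converse
  -- `rem-add⇒add-rem` rests on the same observation.
  add-rem⇒rem-add : Addable g i → Removable (inc g i) j → Removable g j × Addable (dec g j) i
  add-rem⇒rem-add add rem = rem′ , add′ i i≢j add rem
    where
    rem′ : Removable g j
    rem′ = ≤-<-trans (inc-≥ g i (suc j)) (subst (inc g i (suc j) <_) (inc-other g (i≢j ∘ sym)) rem)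
    add′ : ∀ i → i ≢ j → Addable g i → Removable (inc g i) j → Addable (dec g j) i
    add′ zero    _   _   _   = tt
    add′ (suc i) i≢j add rem with i ≟ j
    ... | yes refl = subst₂ _<_ (sym (dec-other g i≢j)) refl (pred-mono-≤
      (subst₂ _<_ (inc-same g (suc j)) (inc-other g (i≢j ∘ sym)) rem))
    ... | no  i≢j′ = subst₂ _<_ (sym (dec-other g i≢j)) refl add

  rem-add⇒add-rem : Removable g j → Addable (dec g j) i → Addable g i × Removable (inc g i) j
  rem-add⇒add-rem rem add = add′ i i≢j add , subst (inc g i (suc j) <_) (sym (inc-other g (i≢j ∘ sym))) rem′
    where
    add′ : ∀ i → i ≢ j → Addable (dec g j) i → Addable g i
    add′ zero    _   _   = tt
    add′ (suc i) i≢j add = subst (_< g i) (dec-other g i≢j) (<-≤-trans add (dec-≤ g j i))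
    rem′ : inc g i (suc j) < g j
    rem′ with suc j ≟ i
    ... | no  _    = rem
    ... | yes refl = subst (_< g j) (cong suc (dec-other g i≢j))
      (suc-<-pred (subst (dec g j (suc j) <_) (dec-same g j) add))
      where
      suc-<-pred : ∀ {m n} → m < pred n → suc m < n
      suc-<-pred {n = suc n} m<n = s≤s m<n

-- Young's lattice as a differential poset

-- Functions on shapes carry the transposes of the operators adding and removing a cell, so
-- that DU = UD + 1 becomes Up ∘ Dn = Dn ∘ Up + 1. Only rows below N are taken into account.
Up Dn : ℕ → (Shape → ℕ) → Shape → ℕ
Up N F g = ∑ N λ i → ⟦ addable? g i ⟧ * F (inc g i)
Dn N F g = ∑ N λ j → ⟦ removable? g j ⟧ * F (dec g j)

Extensional : (Shape → ℕ) → Set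
Extensional F = ∀ {g h} → g ≗ h → F g ≡ F h

-- Row 0 is always addable, and the other addable rows are the successors of the removable rows
-- below `M`. Row `M` is empty, so it adds no removable row. The surplus of one is the 1 in DU - UD
-- = 1.
addable-count : ∀ M g → g M ≡ 0 →
  ∑ (suc M) (λ i → ⟦ addable? g i ⟧) ≡ suc (∑ (suc M) λ j → ⟦ removable? g j ⟧)
addable-count M g gM≡0 = trans (∑-suc M _) (cong suc (sym (trans (∑-last M _)
  (trans (cong (∑ M _ +_) last≡0) (+-identityʳ _)))))
  where
  last≡0 : ⟦ removable? g M ⟧ ≡ 0
  last≡0 with removable? g M
  ... | yes lt = contradiction (subst (g (suc M) <_) gM≡0 lt) λ ()
  ... | no  _  = refl

-- Moves in two different rows commute, so the double sums agree termwise off the diagonal. On the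
-- diagonal a move and its inverse return to `g`, giving one `F g` for each addable row on the left
-- and one for each removable row on the right. Padding both sides with the diagonal of the other
-- keeps the comparison free of subtraction, so that it can be made for each pair of rows.
Up-Dn : ∀ M F g → Extensional F → Decreasing g → g M ≡ 0 →
  Up (suc M) (Dn (suc M) F) g ≡ Dn (suc M) (Up (suc M) F) g + F g
Up-Dn M F g F-ext g↓ gM≡0 = +-cancelʳ-≡ (rems * F g) _ _ (begin
  Up N (Dn N F) g + rems * F g
    ≡⟨ cong₂ _+_ (∑-cong N λ i → sym (∑-*ˡ N ⟦ addable? g i ⟧ _)) (sym (diagonal removable?)) ⟩
  ∑ N (λ i → ∑ N (A i)) + ∑ N (λ i → ∑ N λ j → ⟦ i ≟ j ⟧ * (⟦ removable? g i ⟧ * F g))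
    ≡⟨ merge A (λ i j → ⟦ i ≟ j ⟧ * (⟦ removable? g i ⟧ * F g)) ⟩
  ∑ N (λ i → ∑ N λ j → A i j + ⟦ i ≟ j ⟧ * (⟦ removable? g i ⟧ * F g))
    ≡⟨ ∑-cong N (λ i → ∑-cong N λ j → pointwise i j) ⟩
  ∑ N (λ i → ∑ N λ j → B j i + ⟦ i ≟ j ⟧ * (⟦ addable? g i ⟧ * F g))
    ≡⟨ merge (λ i j → B j i) (λ i j → ⟦ i ≟ j ⟧ * (⟦ addable? g i ⟧ * F g)) ⟨
  ∑ N (λ i → ∑ N λ j → B j i) + ∑ N (λ i → ∑ N λ j → ⟦ i ≟ j ⟧ * (⟦ addable? g i ⟧ * F g))
    ≡⟨ cong₂ _+_ (∑-swap N N (λ i j → B j i)) (diagonal addable?) ⟩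
  ∑ N (λ j → ∑ N (B j)) + adds * F g
    ≡⟨ cong₂ _+_ (∑-cong N λ j → ∑-*ˡ N ⟦ removable? g j ⟧ _) (cong (_* F g) (addable-count M g gM≡0)) ⟩
  Dn N (Up N F) g + (F g + rems * F g)
    ≡⟨ +-assoc (Dn N (Up N F) g) (F g) (rems * F g) ⟨
  Dn N (Up N F) g + F g + rems * F g ∎)
  where
  open ≡-Reasoning
  N    = suc M
  rems = ∑ N λ j → ⟦ removable? g j ⟧
  adds = ∑ N λ i → ⟦ addable? g i ⟧
  A B : ℕ → ℕ → ℕ
  A i j = ⟦ addable? g i ⟧ * (⟦ removable? (inc g i) j ⟧ * F (dec (inc g i) j))
  B j i = ⟦ removable? g j ⟧ * (⟦ addable? (dec g j) i ⟧ * F (inc (dec g j) i))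

  diagonal : {P : Shape → ℕ → Set} (P? : ∀ g i → Dec (P g i)) →
    ∑ N (λ i → ∑ N λ j → ⟦ i ≟ j ⟧ * (⟦ P? g i ⟧ * F g)) ≡ ∑ N (λ i → ⟦ P? g i ⟧) * F g
  diagonal P? = trans (∑-cong< N λ i i<N → ∑-delta N i (⟦ P? g i ⟧ * F g) i<N) (∑-*ʳ N (F g) _)

  merge : ∀ (X Y : ℕ → ℕ → ℕ) →
    ∑ N (λ i → ∑ N (X i)) + ∑ N (λ i → ∑ N (Y i)) ≡ ∑ N (λ i → ∑ N λ j → X i j + Y i j)
  merge X Y = sym (trans (∑-cong N λ i → ∑-+ N (X i) (Y i)) (∑-+ N _ _))

  same-A : ∀ i → A i i ≡ ⟦ addable? g i ⟧ * F g
  same-A i with removable? (inc g i) i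
  ... | yes _ = cong (⟦ addable? g i ⟧ *_) (trans (+-identityʳ _) (F-ext (dec-inc g i)))
  ... | no ¬r = contradiction (removable-inc i g↓) ¬r

  same-B : ∀ i → B i i ≡ ⟦ removable? g i ⟧ * F g
  same-B i with removable? g i
  ... | no _ = refl
  ... | yes r with addable? (dec g i) i
  ...   | yes _ = cong (_+ 0) (trans (+-identityʳ _) (F-ext (inc-dec g i (≤-<-trans z≤n r))))
  ...   | no ¬a = contradiction (addable-dec i g↓ r) ¬a

  different : ∀ {i j} → i ≢ j → A i j ≡ B j i
  different {i} {j} i≢j
    with addable? g i | removable? (inc g i) j | removable? g j | addable? (dec g j) i
       | add-rem⇒rem-add {g} i≢j | rem-add⇒add-rem {g} i≢j
  ... | yes _ | yes _ | yes _ | yes _ | _ | _ = cong (λ x → x + 0 + 0) (F-ext (dec-inc-comm g i≢j))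
  ... | yes a | yes r | no ¬r | _     | ⇒ | _ = contradiction (proj₁ (⇒ a r)) ¬r
  ... | yes a | yes r | yes _ | no ¬a | ⇒ | _ = contradiction (proj₂ (⇒ a r)) ¬a
  ... | no ¬a | _     | yes r | yes a | _ | ⇐ = contradiction (proj₁ (⇐ r a)) ¬a
  ... | yes _ | no ¬r | yes r | yes a | _ | ⇐ = contradiction (proj₂ (⇐ r a)) ¬r
  ... | no _  | _     | no _  | _     | _ | _ = refl
  ... | no _  | _     | yes _ | no _  | _ | _ = refl
  ... | yes _ | no _  | no _  | _     | _ | _ = refl
  ... | yes _ | no _  | yes _ | no _  | _ | _ = refl

  pointwise : ∀ i j →
    A i j + ⟦ i ≟ j ⟧ * (⟦ removable? g i ⟧ * F g) ≡ B j i + ⟦ i ≟ j ⟧ * (⟦ addable? g i ⟧ * F g)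
  pointwise i j with i ≟ j
  ... | no  i≢j  = cong (_+ 0) (different i≢j)
  ... | yes refl = begin
    A i i + (⟦ removable? g i ⟧ * F g + 0) ≡⟨ cong₂ _+_ (same-A i) (trans (+-identityʳ _) (sym (same-B i))) ⟩
    ⟦ addable? g i ⟧ * F g + B i i         ≡⟨ +-comm _ (B i i) ⟩
    B i i + ⟦ addable? g i ⟧ * F g         ≡⟨ cong (B i i +_) (+-identityʳ _) ⟨
    B i i + (⟦ addable? g i ⟧ * F g + 0)   ∎

ups downs : (N n : ℕ) → Shape → ℕ
ups N zero    g = 1
ups N (suc m) g = Up N (ups N m) g
downs N zero    g = 1
downs N (suc n) g = Dn N (downs N n) g

-- Agreement is asked for at removable rows only, since the induction hypothesis it is applied to
-- needs `dec g j` to be decreasing.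
Dn-cong : ∀ N {F G} g → (∀ j → Removable g j → F (dec g j) ≡ G (dec g j)) → Dn N F g ≡ Dn N G g
Dn-cong N g eq = ∑-cong N λ j → ⟦⟧-*-cong (removable? g j) (eq j)

Dn-+ : ∀ N F G g → Dn N (λ h → F h + G h) g ≡ Dn N F g + Dn N G g
Dn-+ N F G g = trans (∑-cong N λ j → *-distribˡ-+ ⟦ removable? g j ⟧ _ _) (∑-+ N _ _)

Dn-* : ∀ N c F g → Dn N (λ h → c * F h) g ≡ c * Dn N F g
Dn-* N c F g = trans (∑-cong N λ j → swap ⟦ removable? g j ⟧ c _) (∑-*ˡ N c _)
  where
  swap : ∀ a b c → a * (b * c) ≡ b * (a * c)
  swap = solve-∀

-- Undoing a move gives back a shape only up to pointwise equality; the counts must respect this for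
-- `Up-Dn` to apply to them.
downs-ext : ∀ N n → Extensional (downs N n)
downs-ext N zero    _  = refl
downs-ext N (suc n) {g} {h} eq = ∑-cong N λ j → cong₂ _*_
  (⟦⟧-cong (removable? g j) (removable? h j) (addable-resp (suc j) eq) (addable-resp (suc j) (sym ∘ eq)))
  (downs-ext N n (dec-cong j eq))

-- Moving `Up` past each of the `n` factors `Dn` leaves one copy of `downs (pred n)` behind, which
-- gives the last term. Having reached the constant function 1, `Up` acts on it as `Dn` plus 1,
-- which gives the first two.
Up-downs : ∀ M n g → Decreasing g → g M ≡ 0 →
  Up (suc M) (downs (suc M) n) g ≡
  downs (suc M) (suc n) g + downs (suc M) n g + n * downs (suc M) (pred n) g
Up-downs M zero g g↓ gM≡0 = begin
  ∑ N (λ i → ⟦ addable? g i ⟧ * 1)             ≡⟨ ∑-cong N (λ i → *-identityʳ _) ⟩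
  ∑ N (λ i → ⟦ addable? g i ⟧)                 ≡⟨ addable-count M g gM≡0 ⟩
  suc (∑ N λ j → ⟦ removable? g j ⟧)           ≡⟨ cong suc (∑-cong N λ j → *-identityʳ _) ⟨
  suc (Dn N (λ _ → 1) g)                       ≡⟨ +-comm 1 _ ⟩
  Dn N (λ _ → 1) g + 1                         ≡⟨ +-identityʳ _ ⟨
  Dn N (λ _ → 1) g + 1 + 0                     ∎
  where
  open ≡-Reasoning
  N = suc M
Up-downs M (suc n) g g↓ gM≡0 = begin
  Up N (Dn N (d n)) g
    ≡⟨ Up-Dn M (d n) g (downs-ext N n) g↓ gM≡0 ⟩
  Dn N (Up N (d n)) g + d n g
    ≡⟨ cong (_+ d n g) (Dn-cong N {Up N (d n)} {λ h → d (suc n) h + d n h + n * d (pred n) h} g λ j rem →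
         Up-downs M n (dec g j) (dec-decreasing j rem g↓)
         (n≤0⇒n≡0 (subst (dec g j M ≤_) gM≡0 (dec-≤ g j M)))) ⟩
  Dn N (λ h → d (suc n) h + d n h + n * d (pred n) h) g + d n g
    ≡⟨ cong (_+ d n g) (trans (Dn-+ N (λ h → d (suc n) h + d n h) (λ h → n * d (pred n) h) g)
         (cong₂ _+_ (Dn-+ N (d (suc n)) (d n) g) (trans (Dn-* N n (d (pred n)) g) (shift n)))) ⟩
  d (suc (suc n)) g + d (suc n) g + n * d n g + d n g
    ≡⟨ trans (+-assoc (d (suc (suc n)) g + d (suc n) g) (n * d n g) (d n g))
         (cong (d (suc (suc n)) g + d (suc n) g +_) (+-comm (n * d n g) (d n g))) ⟩
  d (suc (suc n)) g + d (suc n) g + suc n * d n g ∎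
  where
  open ≡-Reasoning
  N = suc M
  d = downs N
  -- At `n = 0` the truncated `pred` has the wrong value, but the factor `n` cancels it.
  shift : ∀ n → n * Dn N (d (pred n)) g ≡ n * d n g
  shift zero    = refl
  shift (suc n) = refl

-- Binomial sums and the closed form.

-- Pairs of an i-subset and a point of an m-set, sorted by whether the point lies outside or inside
-- the subset. This is (i+1) C(m,i+1) = (m-i) C(m,i) without subtraction, so that Pascal's rule and
-- ring arithmetic carry the induction with no bound on `i`.
absorption : ∀ m i → suc i * (m C suc i) + i * (m C i) ≡ m * (m C i)
absorption zero    zero    = refl
absorption zero    (suc i) = cong₂ _+_
  (trans (cong (suc (suc i) *_) (k>n⇒nCk≡0 {k = suc (suc i)} (s≤s z≤n))) (*-zeroʳ (suc (suc i))))
  (trans (cong (suc i *_) (k>n⇒nCk≡0 {k = suc i} (s≤s z≤n))) (*-zeroʳ (suc i)))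
absorption (suc m) zero    = trans (trans (+-identityʳ _) (trans (*-identityˡ _) (nC1≡n (suc m)))) (sym (*-identityʳ (suc m)))
absorption (suc m) (suc i) = begin
  suc (suc i) * (suc m C suc (suc i)) + suc i * (suc m C suc i)
    ≡⟨ cong₂ _+_ (cong (suc (suc i) *_) (sym (nCk+nC[k+1]≡[n+1]C[k+1] m (suc i))))
                 (cong (suc i *_) (sym (nCk+nC[k+1]≡[n+1]C[k+1] m i))) ⟩
  suc (suc i) * (b + c) + suc i * (a + b)
    ≡⟨ regroup i a b c ⟩
  (suc (suc i) * c + suc i * b) + (suc i * b + i * a) + (a + b)
    ≡⟨ cong (_+ (a + b)) (cong₂ _+_ (absorption m (suc i)) (absorption m i)) ⟩
  m * b + m * a + (a + b)
    ≡⟨ collect m a b ⟩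
  suc m * (a + b)
    ≡⟨ cong (suc m *_) (nCk+nC[k+1]≡[n+1]C[k+1] m i) ⟩
  suc m * (suc m C suc i) ∎
  where
  open ≡-Reasoning
  a = m C i
  b = m C suc i
  c = m C suc (suc i)
  regroup : ∀ i a b c → suc (suc i) * (b + c) + suc i * (a + b)
    ≡ (suc (suc i) * c + suc i * b) + (suc i * b + i * a) + (a + b)
  regroup = solve-∀
  collect : ∀ m a b → m * b + m * a + (a + b) ≡ suc m * (a + b)
  collect = solve-∀

-- Of the involution numbers only the initial values and the recurrence enter. As a parameter, `s`
-- cannot unfold into the enumeration that defines `t`.
module ClosedForm (s : ℕ → ℕ) (s₀ : s 0 ≡ 1) (s₁ : s 1 ≡ 1)
              (s-rec : ∀ m → s (suc (suc m)) ≡ s (suc m) + suc m * s m) where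

  closed : ℕ → (ℕ → ℕ) → ℕ
  closed m d = ∑ (suc m) λ i → (m C i) * s (m ∸ i) * d i

  closed-cong : ∀ m {d d′} → d ≗ d′ → closed m d ≡ closed m d′
  closed-cong m eq = ∑-cong (suc m) λ i → cong ((m C i) * s (m ∸ i) *_) (eq i)

  closed-Up : ∀ N m (d : ℕ → Shape → ℕ) g →
    Up N (λ h → closed m λ i → d i h) g ≡ closed m λ i → Up N (d i) g
  closed-Up N m d g = begin
    ∑ N (λ r → ⟦ addable? g r ⟧ * closed m (λ i → d i (inc g r)))
      ≡⟨ ∑-cong N (λ r → sym (∑-*ˡ (suc m) ⟦ addable? g r ⟧ _)) ⟩
    ∑ N (λ r → ∑ (suc m) λ i → ⟦ addable? g r ⟧ * ((m C i) * s (m ∸ i) * d i (inc g r)))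
      ≡⟨ ∑-swap N (suc m) _ ⟩
    ∑ (suc m) (λ i → ∑ N λ r → ⟦ addable? g r ⟧ * ((m C i) * s (m ∸ i) * d i (inc g r)))
      ≡⟨ ∑-cong (suc m) (λ i → trans (∑-cong N λ r → swap ⟦ addable? g r ⟧ ((m C i) * s (m ∸ i)) (d i (inc g r)))
           (∑-*ˡ N ((m C i) * s (m ∸ i)) _)) ⟩
    closed m (λ i → Up N (d i) g) ∎
    where
    open ≡-Reasoning
    swap : ∀ a b c → a * (b * c) ≡ b * (a * c)
    swap = solve-∀

  -- C(m,i+1) (i+1) = C(m,i) (m−i) turns the lowering term into the recurrence of s.
  lowering : ∀ m i → i ≤ m → (m C i) * s (suc m ∸ i) ≡
    (m C i) * s (m ∸ i) + suc i * (m C suc i) * s (m ∸ suc i)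
  lowering m i i≤m = begin
    (m C i) * s (suc m ∸ i)
      ≡⟨ cong (λ x → (m C i) * s x) (+-∸-assoc 1 i≤m) ⟩
    (m C i) * s (suc (m ∸ i))
      ≡⟨ step (m ∸ i) refl ⟩
    (m C i) * s (m ∸ i) + suc i * (m C suc i) * s (pred (m ∸ i))
      ≡⟨ cong (λ x → (m C i) * s (m ∸ i) + suc i * (m C suc i) * s x) (pred[m∸n]≡m∸[1+n] m i) ⟩
    (m C i) * s (m ∸ i) + suc i * (m C suc i) * s (m ∸ suc i) ∎
    where
    open ≡-Reasoning
    absorbed : suc i * (m C suc i) ≡ (m ∸ i) * (m C i)
    absorbed = +-cancelʳ-≡ (i * (m C i)) _ _ (trans (absorption m i) (sym
      (trans (sym (*-distribʳ-+ (m C i) (m ∸ i) i)) (cong (_* (m C i)) (m∸n+n≡m i≤m)))))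
    step : ∀ e → m ∸ i ≡ e →
      (m C i) * s (suc e) ≡ (m C i) * s e + suc i * (m C suc i) * s (pred e)
    -- Here `m ≡ i`: the second binomial is 0, and `s 1 ≡ s 0` takes the place of the recurrence.
    step zero eq = begin
      (m C i) * s 1             ≡⟨ cong ((m C i) *_) (trans s₁ (sym s₀)) ⟩
      (m C i) * s 0             ≡⟨ +-identityʳ _ ⟨
      (m C i) * s 0 + 0 * s 0   ≡⟨ cong (λ x → (m C i) * s 0 + x * s 0) (trans absorbed (cong (_* (m C i)) eq)) ⟨
      (m C i) * s 0 + suc i * (m C suc i) * s 0 ∎
    step (suc e) eq = begin
      (m C i) * s (suc (suc e))
        ≡⟨ cong ((m C i) *_) (s-rec e) ⟩
      (m C i) * (s (suc e) + suc e * s e)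
        ≡⟨ regroup (m C i) (s (suc e)) (suc e) (s e) ⟩
      (m C i) * s (suc e) + suc e * (m C i) * s e
        ≡⟨ cong (λ x → (m C i) * s (suc e) + x * s e) (trans absorbed (cong (_* (m C i)) eq)) ⟨
      (m C i) * s (suc e) + suc i * (m C suc i) * s e ∎
      where
      regroup : ∀ a b c d → a * (b + c * d) ≡ a * b + c * a * d
      regroup = solve-∀

  -- Compare the coefficients of `d i`. The last two terms together contribute C(m,i) s(m+1-i) by
  -- `lowering`, the first contributes C(m,i-1) s(m+1-i), and Pascal's rule adds them up.
  closed-suc : ∀ m d → closed m (λ i → d (suc i) + d i + i * d (pred i)) ≡ closed (suc m) d
  closed-suc m d = begin
    closed m (λ i → d (suc i) + d i + i * d (pred i))
      ≡⟨ ∑-cong (suc m) (λ i → distribute (c i) (d (suc i)) (d i) (i * d (pred i))) ⟩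
    ∑ (suc m) (λ i → (c i * d i + c i * (i * d (pred i))) + c i * d (suc i))
      ≡⟨ trans (∑-+ (suc m) _ _) (cong (_+ raised) (∑-+ (suc m) _ _)) ⟩
    ∑ (suc m) (λ i → c i * d i) + ∑ (suc m) (λ i → c i * (i * d (pred i))) + raised
      ≡⟨ cong (λ x → ∑ (suc m) (λ i → c i * d i) + x + raised) lowered ⟩
    ∑ (suc m) (λ i → c i * d i) + ∑ (suc m) (λ i → suc i * (m C suc i) * s (m ∸ suc i) * d i) + raised
      ≡⟨ cong (_+ raised) (sym (∑-+ (suc m) _ _)) ⟩
    ∑ (suc m) (λ i → c i * d i + suc i * (m C suc i) * s (m ∸ suc i) * d i) + raised
      ≡⟨ cong (_+ raised) (∑-cong< (suc m) λ { i (s≤s i≤m) →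
           sym (trans (cong (_* d i) (lowering m i i≤m)) (*-distribʳ-+ (d i) (c i) _)) }) ⟩
    ∑ (suc m) (λ i → (m C i) * s (suc m ∸ i) * d i) + raised
      -- The summand at `suc m` vanishes with its binomial. Including it allows splitting off index
      -- 0, after which the sum is aligned with `raised`.
      ≡⟨ cong (_+ raised) (∑-extend (suc m) 1 (λ i → (m C i) * s (suc m ∸ i) * d i) λ i m<i →
           cong (λ x → x * s (suc m ∸ i) * d i) (k>n⇒nCk≡0 m<i)) ⟨
    ∑ (suc (suc m)) (λ i → (m C i) * s (suc m ∸ i) * d i) + raised
      ≡⟨ cong (_+ raised) (∑-suc (suc m) _) ⟩
    first + ∑ (suc m) (λ i → (m C suc i) * s (m ∸ i) * d (suc i)) + raised
      ≡⟨ +-assoc first _ raised ⟩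
    first + (∑ (suc m) (λ i → (m C suc i) * s (m ∸ i) * d (suc i)) + raised)
      ≡⟨ cong (first +_) (trans (sym (∑-+ (suc m) _ _)) (∑-cong (suc m) λ i → pascal i)) ⟩
    first + ∑ (suc m) (λ i → (suc m C suc i) * s (m ∸ i) * d (suc i))
      ≡⟨ ∑-suc (suc m) _ ⟨
    closed (suc m) d ∎
    where
    open ≡-Reasoning
    c : ℕ → ℕ
    c i = (m C i) * s (m ∸ i)
    raised = ∑ (suc m) λ i → c i * d (suc i)
    first  = 1 * s (suc m) * d 0
    distribute : ∀ c x y z → c * (x + y + z) ≡ (c * y + c * z) + c * x
    distribute = solve-∀
    -- The index shifts by one without boundary terms: on the left the summand at 0 has the factor
    -- `i`, on the right the summand at `m` has the binomial C(m,m+1).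
    lowered : ∑ (suc m) (λ i → c i * (i * d (pred i))) ≡
      ∑ (suc m) (λ i → suc i * (m C suc i) * s (m ∸ suc i) * d i)
    lowered = begin
      ∑ (suc m) (λ i → c i * (i * d (pred i)))
        ≡⟨ ∑-suc m _ ⟩
      c 0 * 0 + ∑ m (λ i → c (suc i) * (suc i * d i))
        ≡⟨ cong (_+ ∑ m (λ i → c (suc i) * (suc i * d i))) (*-zeroʳ (c 0)) ⟩
      ∑ m (λ i → c (suc i) * (suc i * d i))
        ≡⟨ ∑-cong m (λ i → regroup (m C suc i) (s (m ∸ suc i)) (suc i) (d i)) ⟩
      ∑ m (λ i → suc i * (m C suc i) * s (m ∸ suc i) * d i)
        ≡⟨ ∑-extend m 1 _ (λ i m≤i → cong (λ x → x * s (m ∸ suc i) * d i)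
             (trans (cong (suc i *_) (k>n⇒nCk≡0 {k = suc i} (s≤s m≤i))) (*-zeroʳ (suc i)))) ⟨
      ∑ (suc m) (λ i → suc i * (m C suc i) * s (m ∸ suc i) * d i) ∎
      where
      regroup : ∀ a b c d → a * b * (c * d) ≡ c * a * b * d
      regroup = solve-∀
    pascal : ∀ i → (m C suc i) * s (m ∸ i) * d (suc i) + c i * d (suc i)
      ≡ (suc m C suc i) * s (m ∸ i) * d (suc i)
    pascal i = trans (collect (m C suc i) (m C i) (s (m ∸ i)) (d (suc i)))
      (cong (λ x → x * s (m ∸ i) * d (suc i)) (nCk+nC[k+1]≡[n+1]C[k+1] m i))
      where
      collect : ∀ a b x y → a * x * y + b * x * y ≡ (b + a) * x * y
      collect = solve-∀

  -- L + m ≤ N makes sure that no row met on the way lies outside the range of the sums.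
  ups-closed : ∀ N m L g → L + m ≤ N → Decreasing g → (∀ r → L ≤ r → g r ≡ 0) →
    ups N m g ≡ closed m λ i → downs N i g
  ups-closed N zero    L g _     _  _    = sym (trans (∑-suc 0 _) (cong₂ (λ x y → 1 * x * 1 + y) s₀ (∑-empty _)))
  ups-closed zero (suc m) L g bound _ _ = contradiction (≤-trans (m≤n+m (suc m) L) bound) λ ()
  ups-closed N@(suc M) (suc m) L g bound g↓ supp = begin
    Up N (ups N m) g
      ≡⟨ ∑-cong N (λ i → ⟦⟧-*-cong (addable? g i) λ add → ups-closed N m (suc L) (inc g i)
           (subst (_≤ N) (+-suc L m) bound) (inc-decreasing i add g↓) (supp′ i add)) ⟩
    Up N (λ h → closed m λ i → downs N i h) g
      ≡⟨ closed-Up N m (downs N) g ⟩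
    closed m (λ i → Up N (downs N i) g)
      ≡⟨ closed-cong m (λ i → Up-downs M i g g↓ (supp M (≤-pred (≤-trans
           (subst (_≤ L + suc m) (+-comm L 1) (+-monoʳ-≤ L (s≤s z≤n))) bound)))) ⟩
    closed m (λ i → downs N (suc i) g + downs N i g + i * downs N (pred i) g)
      ≡⟨ closed-suc m (λ i → downs N i g) ⟩
    closed (suc m) (λ i → downs N i g) ∎
    where
    open ≡-Reasoning
    supp′ : ∀ i → Addable g i → ∀ r → suc L ≤ r → inc g i r ≡ 0
    supp′ i add r L<r with r ≟ i
    ... | no  _ = supp r (<⇒≤ L<r)
    supp′ i add (suc r) (s≤s L≤r) | yes refl = contradiction (subst (g (suc r) <_) (supp r L≤r) add) λ ()

-- Counting by correspondences

∈-─ : {A : Set} {x y : A} {xs : List A} (x∈ : x ∈ xs) → y ∈ xs → y ≢ x → y ∈ (xs ─ x∈)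
∈-─ (here refl) (here refl) y≢x = contradiction refl y≢x
∈-─ (here refl) (there y∈)  y≢x = y∈
∈-─ (there x∈)  (here refl) y≢x = here refl
∈-─ (there x∈)  (there y∈)  y≢x = there (∈-─ x∈ y∈ y≢x)

-- A partner of the head is struck out of `ys`; injectivity keeps the partners of the tail different
-- from it. A relation in place of a function spares explicit maps between tableaux and words, and
-- the equations saying that they are inverse.
length-≤ : {A B : Set} (R : A → B → Set) {xs : List A} {ys : List B} → List.Unique xs →
  (∀ {x} → x ∈ xs → ∃ λ y → y ∈ ys × R x y) →
  (∀ {x x′ y} → x ∈ xs → x′ ∈ xs → R x y → R x′ y → x ≡ x′) →
  length xs ≤ length ys
length-≤ R {[]}     []        _   _   = z≤n
length-≤ R {x ∷ xs} {ys} (x∉ ∷ xs!) rel inj with rel (here refl)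
... | y , y∈ , xRy = subst (suc (length xs) ≤_) (sym (length-removeAt′ ys (index y∈)))
  (s≤s (length-≤ R xs! rel′ λ x∈ x′∈ → inj (there x∈) (there x′∈)))
  where
  rel′ : ∀ {x′} → x′ ∈ xs → ∃ λ y′ → y′ ∈ (ys ─ y∈) × R x′ y′
  rel′ x′∈ with rel (there x′∈)
  ... | y′ , y′∈ , x′Ry′ = y′ , ∈-─ y∈ y′∈
    (λ { refl → All.lookup x∉ x′∈ (inj (here refl) (there x′∈) xRy x′Ry′) }) , x′Ry′

length-≡ : {A B : Set} (R : A → B → Set) {xs : List A} {ys : List B} →
  List.Unique xs → List.Unique ys →
  (∀ {x} → x ∈ xs → ∃ λ y → y ∈ ys × R x y) →
  (∀ {y} → y ∈ ys → ∃ λ x → x ∈ xs × R x y) →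
  (∀ {x x′ y} → x ∈ xs → x′ ∈ xs → R x y → R x′ y → x ≡ x′) →
  (∀ {x y y′} → x ∈ xs → R x y → R x y′ → y ≡ y′) →
  length xs ≡ length ys
length-≡ R {xs} {ys} xs! ys! to from inj fun =
  ≤-antisym (length-≤ R xs! to inj)
            (length-≤ (λ y x → x ∈ xs × R x y) ys!
              (λ y∈ → let x , x∈ , xRy = from y∈ in x , x∈ , x∈ , xRy)
              λ _ _ (x∈ , xRy) (_ , xRy′) → fun x∈ xRy xRy′)

concatMap-unique : {A B : Set} (F : A → List B) {xs : List A} → List.Unique xs →
  (∀ x → List.Unique (F x)) → (∀ {x x′ y} → y ∈ F x → y ∈ F x′ → x ≡ x′) →
  List.Unique (concatMap F xs)
concatMap-unique F {[]}     []         _   _    = []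
concatMap-unique F {x ∷ xs} (x∉ ∷ xs!) F! disj =
  Unique.++⁺ (F! x) (concatMap-unique F xs! F! disj) λ (y∈ , y∈′) →
    let x′ , x′∈ , y∈Fx′ = find (∈-concatMap⁻ F {xs = xs} y∈′)
    in All.lookup x∉ x′∈ (disj y∈ y∈Fx′)

length-concatMap : {A B : Set} (F : A → List B) (xs : List A) →
  length (concatMap F xs) ≡ sum (map (length ∘ F) xs)
length-concatMap F []       = refl
length-concatMap F (x ∷ xs) = trans (length-++ (F x)) (cong (length (F x) +_) (length-concatMap F xs))

-- The type of a filling depends on its shape. Dependent pairs put the tableaux of all shapes into
-- one list, whose length is the sum over the shapes.
Σ-list : {A : Set} {B : A → Set} → List A → ((a : A) → List (B a)) → List (Σ A B)
Σ-list xs ys = concatMap (λ a → map (a ,_) (ys a)) xs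

Σ-list-length : {A : Set} {B : A → Set} (xs : List A) (ys : (a : A) → List (B a)) →
  length (Σ-list xs ys) ≡ sum (map (length ∘ ys) xs)
Σ-list-length []       ys = refl
Σ-list-length {A} {B} (x ∷ xs) ys = trans (length-++ (map pair (ys x)))
  (cong₂ _+_ (length-map pair (ys x)) (Σ-list-length xs ys))
  where
  pair : B x → Σ A B
  pair = x ,_

Σ-list-unique : {A : Set} {B : A → Set} {xs : List A} {ys : (a : A) → List (B a)} →
  List.Unique xs → (∀ a → List.Unique (ys a)) → List.Unique (Σ-list xs ys)
Σ-list-unique {ys = ys} xs! ys! = concatMap-unique _ xs! (λ a → Unique.map⁺ (λ { refl → refl }) (ys! a))
  λ y∈ y∈′ → trans (sym (fst y∈)) (fst y∈′)
  where
  fst : ∀ {a p} → p ∈ map (a ,_) (ys a) → proj₁ p ≡ a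
  fst {a} p∈ with ∈-map⁻ (a ,_) p∈
  ... | _ , _ , refl = refl

∈-Σ-list⁺ : {A : Set} {B : A → Set} {xs : List A} {ys : (a : A) → List (B a)} {a : A} {b : B a} →
  a ∈ xs → b ∈ ys a → (a , b) ∈ Σ-list xs ys
∈-Σ-list⁺ a∈ b∈ = ∈-concatMap⁺ _ (lose a∈ (∈-map⁺ _ b∈))

∈-Σ-list⁻ : {A : Set} {B : A → Set} {xs : List A} {ys : (a : A) → List (B a)} {a : A} {b : B a} →
  (a , b) ∈ Σ-list xs ys → a ∈ xs × b ∈ ys a
∈-Σ-list⁻ {xs = xs} ab∈ with find (∈-concatMap⁻ _ {xs = xs} ab∈)
... | _ , a∈ , ab∈′ with ∈-map⁻ _ ab∈′
... | _ , b∈ , refl = a∈ , b∈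

vectors-unique : {A : Set} {xs : List A} (n : ℕ) → List.Unique xs → List.Unique (vectors xs n)
vectors-unique zero    xs! = [] ∷ []
vectors-unique (suc n) xs! = Unique.cartesianProductWith⁺ _∷_ Vec.∷-injective xs! (vectors-unique n xs!)

∈-vectors : {A : Set} {xs : List A} {n : ℕ} (v : Vec A n) → (∀ i → lookup v i ∈ xs) → v ∈ vectors xs n
∈-vectors []      _  = here refl
∈-vectors (x ∷ v) v∈ = ∈-cartesianProductWith⁺ _∷_ (v∈ zero) (∈-vectors v (v∈ ∘ suc))

length-product : {A B : Set} (xs : List A) (ys : List B) →
  length (cartesianProduct xs ys) ≡ length xs * length ys
length-product []       ys = refl
length-product (x ∷ xs) ys = trans (length-++ (map (x ,_) ys))
  (cong₂ _+_ (length-map (x ,_) ys) (length-product xs ys))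

allVectors : (m n : ℕ) → List (Vec (Fin m) n)
allVectors m n = vectors (allFin m) n

∈-allVectors : ∀ {m n} (v : Vec (Fin m) n) → v ∈ allVectors m n
∈-allVectors v = ∈-vectors v λ i → ∈-allFin (lookup v i)

lookup-extensional : ∀ {A : Set} {n} (u v : Vec A n) → (∀ i → lookup u i ≡ lookup v i) → u ≡ v
lookup-extensional u v eq = trans (sym (Vec.tabulate∘lookup u)) (trans (Vec.tabulate-cong eq) (Vec.tabulate∘lookup v))

skolem : ∀ {A : Set} {n} {P : Fin n → A → Set} → (∀ i → ∃ (P i)) → ∃ λ (v : Vec A n) → ∀ i → P i (lookup v i)
skolem {P = P} ex = tabulate (proj₁ ∘ ex) , λ i → subst (P i) (sym (lookup∘tabulate _ i)) (proj₂ (ex i))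

-- Involutions

involutions : ∀ m → List (Vec (Fin m) m)
involutions m = filter isInvolution? (allVectors m m)

involutions-unique : ∀ m → List.Unique (involutions m)
involutions-unique m = Unique.filter⁺ isInvolution? (vectors-unique m (Unique.allFin⁺ m))

module InvolutionRecurrence (m : ℕ) where

  Target : Set
  Target = Vec (Fin (suc m)) (suc m) ⊎ Fin (suc m) × Vec (Fin m) m

  -- An involution either fixes the first point or swaps it with some other point.
  targets : List Target
  targets = map inj₁ (involutions (suc m)) ++ map inj₂ (cartesianProduct (allFin (suc m)) (involutions m))

  -- In the second case `suc (punchIn j i)` numbers the points other than 0 and `suc j`, and `σ` is
  -- the action of `π` outside this 2-cycle, expressed in these numbers.
  Restricts : Vec (Fin (2 + m)) (2 + m) → Target → Set
  Restricts π (inj₁ σ)       = lookup π zero ≡ zero × ∀ i → lookup π (suc i) ≡ suc (lookup σ i)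
  Restricts π (inj₂ (j , σ)) = lookup π zero ≡ suc j × lookup π (suc j) ≡ zero ×
    ∀ i → lookup π (suc (punchIn j i)) ≡ suc (punchIn j (lookup σ i))

  targets-unique : List.Unique targets
  targets-unique = Unique.++⁺ (Unique.map⁺ inj₁-injective (involutions-unique (suc m)))
    (Unique.map⁺ inj₂-injective (Unique.cartesianProduct⁺ (Unique.allFin⁺ (suc m)) (involutions-unique m)))
    λ (p , q) → case (∈-map⁻ inj₁ p) (∈-map⁻ inj₂ q)
    where
    case : ∀ {x} {P : Vec (Fin (suc m)) (suc m) → Set} {Q : Fin (suc m) × Vec (Fin m) m → Set} →
      (∃ λ a → P a × x ≡ inj₁ a) → ¬ (∃ λ b → Q b × x ≡ inj₂ b)
    case (_ , _ , refl) (_ , _ , ())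

  length-targets : length targets ≡ t (suc m) + suc m * t m
  length-targets = begin
    length targets
      ≡⟨ length-++ (map inj₁ (involutions (suc m))) ⟩
    length (map inj₁ (involutions (suc m))) +
    length (map inj₂ (cartesianProduct (allFin (suc m)) (involutions m)))
      ≡⟨ cong₂ _+_ (length-map inj₁ (involutions (suc m)))
                   (length-map inj₂ (cartesianProduct (allFin (suc m)) (involutions m))) ⟩
    t (suc m) + length (cartesianProduct (allFin (suc m)) (involutions m))
      ≡⟨ cong (t (suc m) +_) (length-product (allFin (suc m)) (involutions m)) ⟩
    t (suc m) + length (allFin (suc m)) * t m
      ≡⟨ cong (λ x → t (suc m) + x * t m) (length-tabulate {n = suc m} (λ i → i)) ⟩
    t (suc m) + suc m * t m ∎
    where open ≡-Reasoning

  restrict : ∀ π → IsInvolution π → ∃ λ y → y ∈ targets × Restricts π y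
  restrict π inv with lookup π zero in π0
  ... | zero = inj₁ σ , ∈-++⁺ˡ (∈-map⁺ inj₁ (∈-filter⁺ isInvolution? (∈-allVectors σ) σ-inv)) , π0 , σ-spec
    where
    preimage : ∀ i x → lookup π (suc i) ≡ x → ∃ λ y → lookup π (suc i) ≡ suc y
    -- A value 0 would give `suc i ≡ zero` on applying `π` once more.
    preimage i zero    eq = contradiction (trans (sym π0) (trans (cong (lookup π) (sym eq)) (inv (suc i)))) λ ()
    preimage i (suc y) eq = y , eq
    σ,spec = skolem λ i → preimage i _ refl
    σ = proj₁ σ,spec
    σ-spec = proj₂ σ,spec
    σ-inv : IsInvolution σ
    σ-inv i = Fin.suc-injective (trans (sym (σ-spec (lookup σ i)))
      (trans (cong (lookup π) (sym (σ-spec i))) (inv (suc i))))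
  ... | suc j = inj₂ (j , σ) ,
    ∈-++⁺ʳ (map inj₁ (involutions (suc m))) (∈-map⁺ inj₂ (∈-cartesianProduct⁺ (∈-allFin j)
      (∈-filter⁺ isInvolution? (∈-allVectors σ) σ-inv))) ,
    π0 , πj , σ-spec
    where
    πj : lookup π (suc j) ≡ zero
    πj = trans (cong (lookup π) (sym π0)) (inv zero)
    -- Points outside the 2-cycle stay outside it: on applying `π` once more, a value 0 would give
    -- `punchIn j i ≡ j`, and a value `suc j` would make a successor equal to 0.
    preimage : ∀ i x → lookup π (suc (punchIn j i)) ≡ x → ∃ λ y → lookup π (suc (punchIn j i)) ≡ suc (punchIn j y)
    preimage i zero eq = contradiction (sym (Fin.suc-injective
      (trans (sym π0) (trans (cong (lookup π) (sym eq)) (inv (suc (punchIn j i))))))) (Fin.punchInᵢ≢i j i)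
    preimage i (suc x) eq with j Fin.≟ x
    ... | no  j≢x  = punchOut j≢x , trans eq (cong suc (sym (Fin.punchIn-punchOut j≢x)))
    ... | yes refl = contradiction (trans (sym πj) (trans (cong (lookup π) (sym eq)) (inv (suc (punchIn j i))))) λ ()
    σ,spec = skolem λ i → preimage i _ refl
    σ = proj₁ σ,spec
    σ-spec = proj₂ σ,spec
    σ-inv : IsInvolution σ
    σ-inv i = Fin.punchIn-injective j _ _ (Fin.suc-injective (trans (sym (σ-spec (lookup σ i)))
      (trans (cong (lookup π) (sym (σ-spec i))) (inv (suc (punchIn j i))))))

  extend : ∀ {y} → y ∈ targets → ∃ λ π → π ∈ involutions (2 + m) × Restricts π y
  extend y∈ with ∈-++⁻ (map inj₁ (involutions (suc m))) y∈
  ... | inj₁ y∈₁ with ∈-map⁻ inj₁ y∈₁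
  ...   | σ , σ∈ , refl = π , ∈-filter⁺ isInvolution? (∈-allVectors π) π-inv , refl , π-spec
    where
    π = zero ∷ tabulate (suc ∘ lookup σ)
    π-spec : ∀ i → lookup π (suc i) ≡ suc (lookup σ i)
    π-spec = lookup∘tabulate (suc ∘ lookup σ)
    π-inv : IsInvolution π
    π-inv zero    = refl
    π-inv (suc i) = trans (cong (lookup π) (π-spec i)) (trans (π-spec (lookup σ i))
      (cong suc (proj₂ (∈-filter⁻ isInvolution? {xs = allVectors (suc m) (suc m)} σ∈) i)))
  extend y∈ | inj₂ y∈₂ with ∈-map⁻ inj₂ y∈₂
  ...   | (j , σ) , jσ∈ , refl = π , ∈-filter⁺ isInvolution? (∈-allVectors π) π-inv , refl , πj , π-spec
    where
    σ-inv : IsInvolution σ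
    σ-inv = proj₂ (∈-filter⁻ isInvolution? {xs = allVectors m m}
      (proj₂ (∈-cartesianProduct⁻ (allFin (suc m)) (involutions m) jσ∈)))
    -- The decision is an argument, so that `value-yes` and `value-no` can split on an arbitrary one
    -- instead of abstracting it inside the tabulated vector.
    value : ∀ x → Dec (j ≡ x) → Fin (2 + m)
    value x (yes _)  = zero
    value x (no j≢x) = suc (punchIn j (lookup σ (punchOut j≢x)))
    π = suc j ∷ tabulate λ x → value x (j Fin.≟ x)
    π-suc : ∀ x → lookup π (suc x) ≡ value x (j Fin.≟ x)
    π-suc = lookup∘tabulate λ x → value x (j Fin.≟ x)
    value-yes : ∀ d → value j d ≡ zero
    value-yes (yes _)  = refl
    value-yes (no j≢j) = contradiction refl j≢j
    value-no : ∀ i d → value (punchIn j i) d ≡ suc (punchIn j (lookup σ i))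
    value-no i (yes eq)  = contradiction (sym eq) (Fin.punchInᵢ≢i j i)
    value-no i (no j≢) = cong (suc ∘ punchIn j ∘ lookup σ)
      (Fin.punchIn-injective j _ _ (Fin.punchIn-punchOut j≢))
    πj : lookup π (suc j) ≡ zero
    πj = trans (π-suc j) (value-yes (j Fin.≟ j))
    π-spec : ∀ i → lookup π (suc (punchIn j i)) ≡ suc (punchIn j (lookup σ i))
    π-spec i = trans (π-suc (punchIn j i)) (value-no i (j Fin.≟ punchIn j i))
    π-inv : IsInvolution π
    π-inv zero = πj
    π-inv (suc x) with j Fin.≟ x
    ... | yes refl = cong (lookup π) πj
    ... | no  j≢x  = subst (λ x → lookup π (lookup π (suc x)) ≡ suc x) (Fin.punchIn-punchOut j≢x)
      (trans (cong (lookup π) (π-spec i)) (trans (π-spec (lookup σ i)) (cong (suc ∘ punchIn j) (σ-inv i))))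
      where i = punchOut j≢x

  restricts-injective : ∀ {π π′} y → Restricts π y → Restricts π′ y → π ≡ π′
  restricts-injective {π} {π′} (inj₁ σ) (π0 , πs) (π′0 , π′s) = lookup-extensional π π′ λ
    { zero    → trans π0 (sym π′0)
    ; (suc i) → trans (πs i) (sym (π′s i)) }
  restricts-injective {π} {π′} (inj₂ (j , σ)) (π0 , πj , πs) (π′0 , π′j , π′s) = lookup-extensional π π′ λ
    { zero    → trans π0 (sym π′0)
    ; (suc x) → at x (j Fin.≟ x) }
    where
    at : ∀ x → Dec (j ≡ x) → lookup π (suc x) ≡ lookup π′ (suc x)
    at x (yes refl) = trans πj (sym π′j)
    at x (no j≢x)   = subst (λ x → lookup π (suc x) ≡ lookup π′ (suc x)) (Fin.punchIn-punchOut j≢x)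
      (trans (πs _) (sym (π′s _)))

  restricts-functional : ∀ {π} y y′ → Restricts π y → Restricts π y′ → y ≡ y′
  restricts-functional (inj₁ σ) (inj₁ σ′) (_ , πs) (_ , πs′) =
    cong inj₁ (lookup-extensional σ σ′ λ i → Fin.suc-injective (trans (sym (πs i)) (πs′ i)))
  restricts-functional (inj₁ σ) (inj₂ _) (π0 , _) (π0′ , _) = contradiction (trans (sym π0) π0′) λ ()
  restricts-functional (inj₂ _) (inj₁ σ) (π0 , _) (π0′ , _) = contradiction (trans (sym π0) π0′) λ ()
  restricts-functional (inj₂ (j , σ)) (inj₂ (j′ , σ′)) (π0 , _ , πs) (π0′ , _ , πs′)
    with Fin.suc-injective (trans (sym π0) π0′)
  ... | refl = cong (λ σ → inj₂ (j , σ)) (lookup-extensional σ σ′ λ i →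
    Fin.punchIn-injective j _ _ (Fin.suc-injective (trans (sym (πs i)) (πs′ i))))

  recurrence : t (2 + m) ≡ t (suc m) + suc m * t m
  recurrence = trans
    (length-≡ Restricts (involutions-unique (2 + m)) targets-unique
      (λ {π} π∈ → restrict π (proj₂ (∈-filter⁻ isInvolution? {xs = allVectors (2 + m) (2 + m)} π∈)))
      extend
      (λ {_} {_} {y} _ _ → restricts-injective y)
      (λ {_} {y} {y′} _ → restricts-functional y y′))
    length-targets

t-recurrence : ∀ m → t (2 + m) ≡ t (suc m) + suc m * t m
t-recurrence m = InvolutionRecurrence.recurrence m

-- Walks in Young's lattice

-- The word records the cells added, each at the first free column of its row, so a start and a word
-- determine all later shapes. The end is fixed only up to `≗`, since shapes are functions.
data Walk : Shape → List Cell → Shape → Set where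
  done : ∀ {g h} → g ≗ h → Walk g [] h
  step : ∀ {g h i j w} → j ≡ g i → Addable g i → Walk (inc g i) w h → Walk g ((i , j) ∷ w) h

Below : ℕ → Shape → Set
Below L g = ∀ r → L ≤ r → g r ≡ 0

walk-resp : ∀ {g g′ h w} → g ≗ g′ → Walk g w h → Walk g′ w h
walk-resp eq (done eq′)             = done λ r → trans (sym (eq r)) (eq′ r)
walk-resp eq (step {i = i} j≡ add w) =
  step (trans j≡ (eq i)) (addable-resp i eq add) (walk-resp (inc-cong i eq) w)

walk-++ : ∀ {g h h′ u v} → Walk g u h → Walk h v h′ → Walk g (u ++ v) h′
walk-++ (done eq)         v = walk-resp (sym ∘ eq) v
walk-++ (step j≡ add u) v = step j≡ add (walk-++ u v)

walk-drop : ∀ {g h h′ u v} → Walk g u h → Walk g (u ++ v) h′ → Walk h v h′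
walk-drop (done eq)      v             = walk-resp eq v
walk-drop (step _ _ u) (step _ _ uv) = walk-drop u uv

walk-≤ : ∀ {g h w} → Walk g w h → ∀ r → g r ≤ h r
walk-≤ (done eq)                     r = ≤-reflexive (eq r)
walk-≤ {g} (step {i = i} _ _ w) r = ≤-trans (inc-≥ g i r) (walk-≤ w r)

decreasing-resp : ∀ {g h} → g ≗ h → Decreasing g → Decreasing h
decreasing-resp eq g↓ r = subst₂ _≤_ (eq (suc r)) (eq r) (g↓ r)

walk-decreasing : ∀ {g h w} → Walk g w h → Decreasing g → Decreasing h
walk-decreasing (done eq)              g↓ = decreasing-resp eq g↓
walk-decreasing (step {i = i} _ add w) g↓ = walk-decreasing w (inc-decreasing i add g↓)

-- An addable row is at most the first one after the occupied range, as the row above it is not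
-- empty.
inc-below : ∀ {g L} i → Addable g i → Below L g → Below (suc L) (inc g i)
inc-below i add supp r L<r with r ≟ i
... | no  _ = supp r (<⇒≤ L<r)
inc-below {g} _ add supp (suc r) (s≤s L≤r) | yes refl =
  contradiction (subst (g (suc r) <_) (supp r L≤r) add) λ ()

walk-below : ∀ {g h w L} → Walk g w h → Below L g → Below (L + length w) h
walk-below {L = L} (done eq) supp r L≤r =
  trans (sym (eq r)) (supp r (subst (_≤ r) (+-identityʳ L) L≤r))
walk-below {h = h} {w = _ ∷ w} {L = L} (step {i = i} _ add v) supp =
  subst (λ L → Below L h) (sym (+-suc L (length w))) (walk-below v (inc-below i add supp))

below-mono : ∀ {g L N} → L ≤ N → Below L g → Below N g
below-mono L≤N supp r N≤r = supp r (≤-trans L≤N N≤r)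

row< : ∀ {g h w N} i → Walk (inc g i) w h → Below N h → i < N
row< {g} {h} {N = N} i w supp with i <? N
... | yes i<N = i<N
... | no  i≮N = contradiction (subst₂ _≤_ (inc-same g i) (supp i (≮⇒≥ i≮N)) (walk-≤ w i)) λ ()

∑-inc : ∀ {N} g i → i < N → ∑ N (inc g i) ≡ suc (∑ N g)
∑-inc {N} g i i<N = begin
  ∑ N (inc g i)                     ≡⟨ ∑-cong N split ⟩
  ∑ N (λ r → ⟦ i ≟ r ⟧ * 1 + g r)   ≡⟨ ∑-+ N _ g ⟩
  ∑ N (λ r → ⟦ i ≟ r ⟧ * 1) + ∑ N g ≡⟨ cong (_+ ∑ N g) (∑-delta N i 1 i<N) ⟩
  suc (∑ N g)                       ∎
  where
  open ≡-Reasoning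
  split : ∀ r → inc g i r ≡ ⟦ i ≟ r ⟧ * 1 + g r
  split r with i ≟ r
  ... | yes refl = inc-same g i
  ... | no  i≢r  = inc-other g (i≢r ∘ sym)

walk-weight : ∀ {g h w N} → Walk g w h → Below N h → ∑ N h ≡ ∑ N g + length w
walk-weight {N = N} (done eq) supp = trans (∑-cong N (sym ∘ eq)) (sym (+-identityʳ _))
walk-weight {g} {w = _ ∷ w} {N} (step {i = i} _ _ v) supp = trans (walk-weight v supp)
  (trans (cong (_+ length w) (∑-inc g i (row< {g} i v supp))) (sym (+-suc (∑ N g) (length w))))

-- Walks are built from their first step, whereas removal acts on their last; this lemma and
-- `walk-unsnoc` connect the two ends. The last cell of row `j` has column `pred (h j)`, since
-- columns count from 0.
walk-snoc : ∀ {g h w} j → Removable h j → Decreasing h → Walk g w (dec h j) → Walk g (w ∷ʳ (j , pred (h j))) h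
walk-snoc {g} {h} j rem h↓ (done eq) = step (sym (trans (eq j) (dec-same h j)))
  (addable-resp j (sym ∘ eq) (addable-dec j h↓ rem))
  (done λ r → trans (inc-cong j eq r) (inc-dec h j (≤-<-trans z≤n rem) r))
walk-snoc j rem h↓ (step j≡ add w) = step j≡ add (walk-snoc j rem h↓ w)

walk-unsnoc : ∀ {g h c} w → Decreasing g → Walk g (w ∷ʳ c) h →
  ∃ λ j → c ≡ (j , pred (h j)) × Removable h j × Walk g w (dec h j)
walk-unsnoc {g} {h} [] g↓ (step {i = i} refl add (done eq)) = i ,
  cong (i ,_) (trans (cong pred (sym (inc-same g i))) (cong pred (eq i))) ,
  addable-resp (suc i) eq (removable-inc i g↓) ,
  done λ r → trans (sym (dec-inc g i r)) (dec-cong i eq r)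
walk-unsnoc (_ ∷ w) g↓ (step {i = i} j≡ add v) =
  let j , c≡ , rem , v′ = walk-unsnoc w (inc-decreasing i add g↓) v
  in j , c≡ , rem , step j≡ add v′

-- Standard tableaux as words of cells.

infix 4 _⊑_

-- Not the componentwise order: only cells in a common row or column are compared, exactly as in the
-- conditions on a standard filling.
_⊑_ : Cell → Cell → Set
(i , j) ⊑ (i′ , j′) = (i ≡ i′ × j ≤ j′) ⊎ (j ≡ j′ × i ≤ i′)

⊑-refl : ∀ {c} → c ⊑ c
⊑-refl = inj₁ (refl , ≤-refl)

Skew : Shape → Shape → Cell → Set
Skew g h (i , j) = g i ≤ j × j < h i

-- As `⊑` is reflexive, this also makes the cells distinct.
Ordered : List Cell → Set
Ordered = AllPairs λ c d → ¬ d ⊑ c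

-- The cells of a standard tableau of shape h/g in the order of their entries.
record Tableau (g h : Shape) (w : List Cell) : Set where
  field
    ordered  : Ordered w
    complete : ∀ {c} → Skew g h c → c ∈ w
    sound    : ∀ {c} → c ∈ w → Skew g h c

  unique : List.Unique w
  unique = AllPairs.map (λ { ¬d⊑c refl → ¬d⊑c ⊑-refl }) ordered

open Tableau

decreasing-≤ : ∀ {g} → Decreasing g → ∀ {i j} → i ≤ j → g j ≤ g i
decreasing-≤ g↓ {i} {zero}  z≤n = ≤-refl
decreasing-≤ g↓ {i} {suc j} i≤j with m≤n⇒m<n∨m≡n i≤j
... | inj₁ (s≤s i≤j′) = ≤-trans (g↓ j) (decreasing-≤ g↓ i≤j′)
... | inj₂ refl       = ≤-refl

-- The first cell `(i , g i)` is the leftmost of its row outside `g`, and the topmost of its column,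
-- because row `i` is addable and thus all rows above are longer. Hence no later cell can be `⊑` it.
walk⇒tableau : ∀ {g h w} → Decreasing g → Walk g w h → Tableau g h w
walk⇒tableau g↓ (done eq) = record
  { ordered  = []
  ; complete = λ { {i , j} (g≤j , j<h) → contradiction
      (<-≤-trans j<h (≤-trans (≤-reflexive (sym (eq i))) g≤j)) (<-irrefl refl) }
  ; sound    = λ ()
  }
walk⇒tableau {g} {h} {_ ∷ w} g↓ (step {i = i} refl add v) = record
  { ordered  = All.tabulate (λ d∈ → not-before (sound tab d∈)) ∷ ordered tab
  ; complete = complete′
  ; sound    = λ { (here refl) → ≤-refl , subst (_≤ h i) (inc-same g i) (walk-≤ v i)
                 ; (there {x} {_} c∈) → ≤-trans (inc-≥ g i _) (proj₁ (sound tab c∈)) , proj₂ (sound tab c∈) }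
  }
  where
  tab = walk⇒tableau (inc-decreasing i add g↓) v
  complete′ : ∀ {c} → Skew g h c → c ∈ (i , g i) ∷ w
  complete′ {r , s} (g≤s , s<h) with r ≟ i
  ... | no r≢i = there (complete tab (subst (_≤ s) (sym (inc-other g r≢i)) g≤s , s<h))
  ... | yes refl with m≤n⇒m<n∨m≡n g≤s
  ...   | inj₁ g<s  = there (complete tab (subst (_≤ s) (sym (inc-same g r)) g<s , s<h))
  ...   | inj₂ refl = here refl
  above : ∀ i → Addable g i → ∀ {r} → r < i → g i < g r
  above (suc i) add (s≤s r≤i) = <-≤-trans add (decreasing-≤ g↓ r≤i)
  not-before : ∀ {d} → Skew (inc g i) h d → ¬ d ⊑ (i , g i)
  not-before {r , s} (g≤s , _) (inj₁ (refl , s≤g)) =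
    <-irrefl refl (<-≤-trans (subst (_≤ s) (inc-same g r) g≤s) s≤g)
  not-before {r , s} (g≤s , _) (inj₂ (refl , r≤i)) with m≤n⇒m<n∨m≡n r≤i
  ... | inj₁ r<i  = <-irrefl refl (<-≤-trans (above i add r<i) (≤-trans (inc-≥ g i r) g≤s))
  ... | inj₂ refl = <-irrefl refl (subst (_≤ s) (inc-same g r) g≤s)

-- No other cell of the skew shape is `⊑` the first cell `(i , j)`. So `(i , g i)` is that cell
-- itself, and the cell above it must belong to `g`, which makes row `i` addable.
tableau⇒walk : ∀ {g h w} → Decreasing g → Decreasing h → (∀ r → g r ≤ h r) → Tableau g h w → Walk g w h
tableau⇒walk {g} {h} {[]} g↓ h↓ g≤h tab = done λ r → ≤-antisym (g≤h r)
  (≮⇒≥ λ g<h → case (complete tab {r , g r} (≤-refl , g<h)))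
  where
  case : ∀ {c} → ¬ c ∈ []
  case ()
tableau⇒walk {g} {h} {(i , j) ∷ w} g↓ h↓ g≤h tab =
  step j≡g add (tableau⇒walk (inc-decreasing i add g↓) h↓ inc≤h rest)
  where
  g≤j = proj₁ (sound tab (here refl))
  j<h = proj₂ (sound tab (here refl))
  first : ∀ {d} → Skew g h d → d ⊑ (i , j) → d ≡ (i , j)
  first d d⊑ with complete tab d
  ... | here d≡  = d≡
  ... | there d∈ = contradiction d⊑ (All.lookup (AllPairs.head (ordered tab)) d∈)
  j≡g : j ≡ g i
  j≡g = sym (cong proj₂ (first {i , g i} (≤-refl , ≤-<-trans g≤j j<h) (inj₁ (refl , g≤j))))
  add : Addable g i
  add = addable i refl
    where
    addable : ∀ i′ → i′ ≡ i → Addable g i′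
    addable zero     _    = _
    addable (suc i′) refl with g (suc i′) <? g i′
    ... | yes lt = lt
    ... | no ¬lt = contradiction (cong proj₁ (first {i′ , j}
      (subst (g i′ ≤_) (sym j≡g) (≮⇒≥ ¬lt) , <-≤-trans j<h (h↓ i′)) (inj₂ (refl , n≤1+n i′)))) λ ()
  inc≤h : ∀ r → inc g i r ≤ h r
  inc≤h r with r ≟ i
  ... | yes refl = subst (_< h r) j≡g j<h
  ... | no  _    = g≤h r
  rest : Tableau (inc g i) h w
  rest = record
    { ordered  = AllPairs.tail (ordered tab)
    ; complete = λ {c} (inc≤ , <h) → later inc≤ (complete tab (≤-trans (inc-≥ g i (proj₁ c)) inc≤ , <h))
    ; sound    = λ { {r , s} c∈ → beyond c∈ , proj₂ (sound tab (there c∈)) }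
    }
    where
    later : ∀ {c} → inc g i (proj₁ c) ≤ proj₂ c → c ∈ (i , j) ∷ w → c ∈ w
    later inc≤ (here refl) = contradiction (subst₂ _≤_ (inc-same g i) j≡g inc≤) (<-irrefl refl)
    later _    (there c∈)  = c∈
    beyond : ∀ {r s} → (r , s) ∈ w → inc g i r ≤ s
    beyond {r} {s} c∈ with r ≟ i
    ... | no  _    = proj₁ (sound tab (there c∈))
    ... | yes refl = ≰⇒> λ s≤g → All.lookup (AllPairs.head (ordered tab)) c∈
      (inj₁ (refl , subst (s ≤_) (sym j≡g) s≤g))

-- Lists of walks.

guard : {P A : Set} → Dec P → List A → List A
guard (yes _) xs = xs
guard (no  _) xs = []

length-guard : {P A : Set} (d : Dec P) (xs : List A) → length (guard d xs) ≡ ⟦ d ⟧ * length xs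
length-guard (yes _) xs = sym (+-identityʳ _)
length-guard (no  _) xs = refl

∈-guard⁻ : {P A : Set} (d : Dec P) {xs : List A} {x : A} → x ∈ guard d xs → P × x ∈ xs
∈-guard⁻ (yes p) x∈ = p , x∈

∈-guard⁺ : {P A : Set} (d : Dec P) {xs : List A} {x : A} → P → x ∈ xs → x ∈ guard d xs
∈-guard⁺ (yes _) p x∈ = x∈
∈-guard⁺ (no ¬p) p x∈ = contradiction p ¬p

guard-unique : {P A : Set} (d : Dec P) {xs : List A} → List.Unique xs → List.Unique (guard d xs)
guard-unique (yes _) xs! = xs!
guard-unique (no  _) _   = []

sum-upTo : ∀ n F → sum (map F (upTo n)) ≡ ∑ n F
sum-upTo n F = trans (cong sum (map-upTo F n)) (go n F)
  where
  go : ∀ n F → sum (applyUpTo F n) ≡ ∑ n F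
  go zero    F = sym (∑-empty F)
  go (suc n) F = trans (cong (F 0 +_) (go n (F ∘ suc))) (sym (∑-suc n F))

module _ (N : ℕ) where

  -- The recursions of `ups` and `downs` with words in place of numbers. In `downWalks` too the
  -- cells are listed in the order in which they are added, so that both lists consist of words of
  -- `Walk`.
  upWalks downWalks : ℕ → Shape → List (List Cell)
  upBlock downBlock : ℕ → Shape → ℕ → List (List Cell)

  upWalks zero    g = [] ∷ []
  upWalks (suc m) g = concatMap (upBlock m g) (upTo N)
  upBlock m g i = guard (addable? g i) (map ((i , g i) ∷_) (upWalks m (inc g i)))

  downWalks zero    h = [] ∷ []
  downWalks (suc n) h = concatMap (downBlock n h) (upTo N)
  downBlock n h j = guard (removable? h j) (map (_∷ʳ (j , pred (h j))) (downWalks n (dec h j)))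

  length-upWalks : ∀ m g → length (upWalks m g) ≡ ups N m g
  length-upWalks zero    g = refl
  length-upWalks (suc m) g = trans (length-concatMap (upBlock m g) (upTo N)) (trans (sum-upTo N _)
    (∑-cong N λ i → trans (length-guard (addable? g i) _)
      (cong (⟦ addable? g i ⟧ *_) (trans (length-map _ (upWalks m (inc g i))) (length-upWalks m (inc g i))))))

  length-downWalks : ∀ n h → length (downWalks n h) ≡ downs N n h
  length-downWalks zero    h = refl
  length-downWalks (suc n) h = trans (length-concatMap (downBlock n h) (upTo N)) (trans (sum-upTo N _)
    (∑-cong N λ j → trans (length-guard (removable? h j) _)
      (cong (⟦ removable? h j ⟧ *_) (trans (length-map _ (downWalks n (dec h j))) (length-downWalks n (dec h j))))))

  ∈-upBlock⁻ : ∀ m g i {w} → w ∈ upBlock m g i →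
    Addable g i × ∃ λ v → v ∈ upWalks m (inc g i) × w ≡ (i , g i) ∷ v
  ∈-upBlock⁻ m g i w∈ with ∈-guard⁻ (addable? g i) w∈
  ... | add , w∈′ = add , ∈-map⁻ _ w∈′

  ∈-downBlock⁻ : ∀ n h j {w} → w ∈ downBlock n h j →
    Removable h j × ∃ λ v → v ∈ downWalks n (dec h j) × w ≡ v ∷ʳ (j , pred (h j))
  ∈-downBlock⁻ n h j w∈ with ∈-guard⁻ (removable? h j) w∈
  ... | rem , w∈′ = rem , ∈-map⁻ _ w∈′

  upWalks-unique : ∀ m g → List.Unique (upWalks m g)
  upWalks-unique zero    g = [] ∷ []
  upWalks-unique (suc m) g = concatMap-unique (upBlock m g) (Unique.upTo⁺ N)
    (λ i → guard-unique (addable? g i) (Unique.map⁺ (proj₂ ∘ ∷-injective) (upWalks-unique m (inc g i))))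
    λ {i} {i′} w∈ w∈′ → same (∈-upBlock⁻ m g i w∈) (∈-upBlock⁻ m g i′ w∈′)
    where
    same : ∀ {i i′ w} {P Q : Set} {X Y : List Cell → Set} →
      P × ∃ (λ v → X v × w ≡ (i , g i) ∷ v) → Q × ∃ (λ v → Y v × w ≡ (i′ , g i′) ∷ v) → i ≡ i′
    same (_ , _ , _ , eq) (_ , _ , _ , eq′) = cong proj₁ (proj₁ (∷-injective (trans (sym eq) eq′)))

  downWalks-unique : ∀ n h → List.Unique (downWalks n h)
  downWalks-unique zero    h = [] ∷ []
  downWalks-unique (suc n) h = concatMap-unique (downBlock n h) (Unique.upTo⁺ N)
    (λ j → guard-unique (removable? h j) (Unique.map⁺ (proj₁ ∘ ∷ʳ-injective _ _) (downWalks-unique n (dec h j))))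
    λ {j} {j′} w∈ w∈′ → same (∈-downBlock⁻ n h j w∈) (∈-downBlock⁻ n h j′ w∈′)
    where
    same : ∀ {j j′ w} {P Q : Set} {X Y : List Cell → Set} →
      P × ∃ (λ v → X v × w ≡ v ∷ʳ (j , pred (h j))) → Q × ∃ (λ v → Y v × w ≡ v ∷ʳ (j′ , pred (h j′))) → j ≡ j′
    same (_ , v , _ , eq) (_ , v′ , _ , eq′) = cong proj₁ (proj₂ (∷ʳ-injective v v′ (trans (sym eq) eq′)))

  upWalks-sound : ∀ m g {w} → w ∈ upWalks m g → length w ≡ m × ∃ λ h → Walk g w h
  upWalks-sound zero    g (here refl) = refl , g , done λ _ → refl
  upWalks-sound (suc m) g w∈ with find (∈-concatMap⁻ (upBlock m g) {xs = upTo N} w∈)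
  ... | i , _ , w∈′ with ∈-upBlock⁻ m g i w∈′
  ...   | add , v , v∈ , refl with upWalks-sound m (inc g i) v∈
  ...     | len , h , walk = cong suc len , h , step refl add walk

  upWalks-complete : ∀ {g h w} → Walk g w h → Below N h → w ∈ upWalks (length w) g
  upWalks-complete (done _) _ = here refl
  upWalks-complete {g} (step {i = i} refl add v) supp = ∈-concatMap⁺ _
    (lose (∈-upTo⁺ (row< {g} i v supp)) (∈-guard⁺ (addable? g i) add (∈-map⁺ _ (upWalks-complete v supp))))

  downWalks-sound : ∀ n h {w} → Decreasing h → w ∈ downWalks n h →
    length w ≡ n × ∃ λ g → Decreasing g × Walk g w h
  downWalks-sound zero    h h↓ (here refl) = refl , h , h↓ , done λ _ → refl
  downWalks-sound (suc n) h h↓ w∈ with find (∈-concatMap⁻ (downBlock n h) {xs = upTo N} w∈)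
  ... | j , _ , w∈′ with ∈-downBlock⁻ n h j w∈′
  ...   | rem , v , v∈ , refl with downWalks-sound n (dec h j) (dec-decreasing j rem h↓) v∈
  ...     | len , g , g↓ , walk =
    trans (length-++ v) (trans (+-comm _ 1) (cong suc len)) , g , g↓ , walk-snoc j rem h↓ walk

  downWalks-complete : ∀ n {g h w} → length w ≡ n → Decreasing g → Walk g w h → Below N h → w ∈ downWalks n h
  downWalks-complete n {w = w} len g↓ walk supp with initLast w
  downWalks-complete zero    len g↓ walk supp | [] = here refl
  downWalks-complete zero    len g↓ walk supp | v ∷ʳ′ c = contradiction (trans (+-comm 1 _) (trans (sym (length-++ v)) len)) λ ()
  downWalks-complete (suc n) {h = h} len g↓ walk supp | v ∷ʳ′ c with walk-unsnoc v g↓ walk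
  ... | j , refl , rem , walk′ = ∈-concatMap⁺ _ (lose (∈-upTo⁺ j<N) (∈-guard⁺ (removable? h j) rem (∈-map⁺ _
    (downWalks-complete n (suc-injective (trans (+-comm 1 _) (trans (sym (length-++ v)) len))) g↓ walk′
      λ r N≤r → n≤0⇒n≡0 (subst (dec h j r ≤_) (supp r N≤r) (dec-≤ h j r))))))
    where
    j<N : j < N
    j<N = ≰⇒> λ N≤j → contradiction (subst (h (suc j) <_) (supp j N≤j) rem) λ ()

-- Partitions and fillings

part-decreasing : ∀ {lam} → Linked _≥_ lam → Decreasing (part lam)
part-decreasing []       _       = z≤n
part-decreasing [-]      _       = z≤n
part-decreasing (x≥y ∷ _) zero   = x≥y
part-decreasing (_ ∷ ys) (suc r) = part-decreasing ys r

linked-part : ∀ lam → Decreasing (part lam) → Linked _≥_ lam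
linked-part []           _  = []
linked-part (x ∷ [])     _  = [-]
linked-part (x ∷ y ∷ lam) g↓ = g↓ 0 ∷ linked-part (y ∷ lam) (g↓ ∘ suc)

part-below : ∀ lam → Below (length lam) (part lam)
part-below []        r       _         = refl
part-below (x ∷ lam) (suc r) (s≤s l≤r) = part-below lam r l≤r

∑-part : ∀ {N} lam → length lam ≤ N → ∑ N (part lam) ≡ sum lam
∑-part {N} []        _         = ∑-zero N _ λ _ → refl
∑-part {suc N} (x ∷ lam) (s≤s l≤N) = trans (∑-suc N _) (cong (x +_) (∑-part lam l≤N))

-- Two lists with the same row lengths differ at most by trailing zeros, which positivity excludes.
part-injective : ∀ {lam mu} → All (0 <_) lam → All (0 <_) mu → part lam ≗ part mu → lam ≡ mu
part-injective []         []         _  = refl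
part-injective []         (0<y ∷ _)  eq = contradiction (subst (0 <_) (sym (eq 0)) 0<y) λ ()
part-injective (0<x ∷ _)  []         eq = contradiction (subst (0 <_) (eq 0) 0<x) λ ()
part-injective (_ ∷ lam+) (_ ∷ mu+)  eq = cong₂ _∷_ (eq 0) (part-injective lam+ mu+ (eq ∘ suc))

length≤sum : ∀ {lam} → All (0 <_) lam → length lam ≤ sum lam
length≤sum []         = z≤n
length≤sum (0<x ∷ lam+) = +-mono-≤ 0<x (length≤sum lam+)

⊆⇒part≤ : ∀ mu lam → mu ⊆ lam → ∀ r → part mu r ≤ part lam r
⊆⇒part≤ []       lam _  r       = z≤n
⊆⇒part≤ (x ∷ mu) []  mu⊆ zero   = mu⊆ zero
⊆⇒part≤ (x ∷ mu) (y ∷ lam) mu⊆ zero = mu⊆ zero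
⊆⇒part≤ (x ∷ mu) []  mu⊆ (suc r) = ⊆⇒part≤ mu [] (mu⊆ ∘ suc) r
⊆⇒part≤ (x ∷ mu) (y ∷ lam) mu⊆ (suc r) = ⊆⇒part≤ mu lam (mu⊆ ∘ suc) r

lookup≡part : ∀ mu (i : Fin (length mu)) → List.lookup mu i ≡ part mu (toℕ i)
lookup≡part (x ∷ mu) zero    = refl
lookup≡part (x ∷ mu) (suc i) = lookup≡part mu i

part≤⇒⊆ : ∀ {mu lam} → (∀ r → part mu r ≤ part lam r) → mu ⊆ lam
part≤⇒⊆ {mu} {lam} le i = subst (_≤ part lam (toℕ i)) (sym (lookup≡part mu i)) (le (toℕ i))

-- An inverse of `part`. The list stops at the first empty row because parts are positive; for a
-- decreasing shape nothing is lost by discarding the rest.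
fromShape : ℕ → Shape → List ℕ
consPositive : ℕ → List ℕ → List ℕ
fromShape zero    g = []
fromShape (suc K) g = consPositive (g 0) (fromShape K (g ∘ suc))
consPositive zero    _   = []
consPositive (suc x) lam = suc x ∷ lam

part-fromShape : ∀ K g → Decreasing g → Below K g → part (fromShape K g) ≗ g
part-fromShape zero    g g↓ supp r = sym (supp r z≤n)
part-fromShape (suc K) g g↓ supp r with g 0 in eq
... | zero = sym (n≤0⇒n≡0 (subst (g r ≤_) eq (decreasing-≤ g↓ z≤n)))
part-fromShape (suc K) g g↓ supp zero    | suc x = sym eq
part-fromShape (suc K) g g↓ supp (suc r) | suc x =
  part-fromShape K (g ∘ suc) (g↓ ∘ suc) (λ r K≤r → supp (suc r) (s≤s K≤r)) r

fromShape-positive : ∀ K g → All (0 <_) (fromShape K g)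
fromShape-positive zero    g = []
fromShape-positive (suc K) g with g 0
... | zero  = []
... | suc x = s≤s z≤n ∷ fromShape-positive K (g ∘ suc)

length-fromShape : ∀ K g → length (fromShape K g) ≤ K
length-fromShape zero    g = z≤n
length-fromShape (suc K) g with g 0
... | zero  = z≤n
... | suc x = s≤s (length-fromShape K (g ∘ suc))

fromShape-partition : ∀ K g → Decreasing g → Below K g → IsPartition (∑ K g) (fromShape K g)
fromShape-partition K g g↓ supp =
  linked-part _ (decreasing-resp (sym ∘ eq) g↓) ,
  fromShape-positive K g ,
  trans (sym (∑-part (fromShape K g) (length-fromShape K g))) (∑-cong K eq)
  where
  eq = part-fromShape K g g↓ supp

listsUpTo-unique : {A : Set} {xs : List A} (n : ℕ) → List.Unique xs → List.Unique (listsUpTo xs n)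
listsUpTo-unique zero    xs! = [] ∷ []
listsUpTo-unique {xs = xs} (suc n) xs! =
  All.tabulate (λ l∈ []≡l → nonempty l∈ []≡l) ∷
  Unique.cartesianProductWith⁺ _∷_ (λ { refl → refl , refl }) xs! (listsUpTo-unique n xs!)
  where
  nonempty : ∀ {l} → l ∈ List.cartesianProductWith _∷_ xs (listsUpTo xs n) → [] ≢ l
  nonempty l∈ refl with ∈-cartesianProductWith⁻ _∷_ xs (listsUpTo xs n) l∈
  ... | _ , _ , _ , _ , ()

∈-listsUpTo : {A : Set} {xs : List A} (n : ℕ) (l : List A) →
  length l ≤ n → (∀ {x} → x ∈ l → x ∈ xs) → l ∈ listsUpTo xs n
∈-listsUpTo zero    []      _         _  = here refl
∈-listsUpTo (suc n) []      _         _  = here refl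
∈-listsUpTo (suc n) (x ∷ l) (s≤s l≤n) l⊆ =
  there (∈-cartesianProductWith⁺ _∷_ (l⊆ (here refl)) (∈-listsUpTo n l l≤n (l⊆ ∘ there)))

partitions-unique : ∀ n → List.Unique (partitions n)
partitions-unique n = Unique.filter⁺ (isPartition? n) (listsUpTo-unique n (Unique.upTo⁺ (suc n)))

∈⇒≤sum : ∀ {x lam} → x ∈ lam → x ≤ sum lam
∈⇒≤sum {lam = y ∷ lam} (here refl) = m≤m+n y (sum lam)
∈⇒≤sum {lam = y ∷ lam} (there x∈)  = ≤-trans (∈⇒≤sum x∈) (m≤n+m (sum lam) y)

∈-partitions⁺ : ∀ {n lam} → IsPartition n lam → lam ∈ partitions n
∈-partitions⁺ {n} {lam} lam⊢n@(_ , lam+ , refl) = ∈-filter⁺ (isPartition? n)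
  (∈-listsUpTo n lam (length≤sum lam+) λ x∈ → ∈-upTo⁺ (s≤s (∈⇒≤sum x∈))) lam⊢n

∈-partitions⁻ : ∀ {n lam} → lam ∈ partitions n → IsPartition n lam
∈-partitions⁻ {n} lam∈ = proj₂ (∈-filter⁻ (isPartition? n) {xs = listsUpTo (upTo (suc n)) n} lam∈)

module _ (lam mu : List ℕ) where

  private
    rowCells : ℕ → List Cell
    rowCells i = map (λ d → i , part mu i + d) (upTo (part lam i ∸ part mu i))

  ∈-cells⁺ : ∀ {c} → Skew (part mu) (part lam) c → c ∈ cells lam mu
  ∈-cells⁺ {i , j} (mu≤j , j<lam) = ∈-concatMap⁺ rowCells (lose
    (∈-upTo⁺ (≰⇒> λ l≤i → contradiction (subst (j <_) (part-below lam i l≤i) j<lam) λ ()))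
    (subst (_∈ rowCells i) (cong (i ,_) (m+[n∸m]≡n mu≤j))
      (∈-map⁺ _ (∈-upTo⁺ (∸-monoˡ-< j<lam mu≤j)))))

  ∈-cells⁻ : ∀ {c} → c ∈ cells lam mu → Skew (part mu) (part lam) c
  ∈-cells⁻ c∈ with find (∈-concatMap⁻ rowCells {xs = upTo (length lam)} c∈)
  ... | i , _ , c∈′ with ∈-map⁻ (λ d → i , part mu i + d) c∈′
  ... | d , d∈ , refl = m≤m+n (part mu i) d ,
    subst (_≤ part lam i) (+-suc (part mu i) d) (m≤n∸o⇒o+m≤n (∈-upTo⁻ d∈))
    where
    m≤n∸o⇒o+m≤n : ∀ {m n o} → suc m ≤ n ∸ o → o + suc m ≤ n
    m≤n∸o⇒o+m≤n {m} {n} {o} m<n∸o = subst (o + suc m ≤_)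
      (m+[n∸m]≡n (<⇒≤ (m<n∸o⇒o<n m<n∸o))) (+-monoʳ-≤ o m<n∸o)
      where
      m<n∸o⇒o<n : ∀ {m} → m < n ∸ o → o < n
      m<n∸o⇒o<n {m} m< = m∸n≢0⇒n<m {n} {o} λ eq → contradiction (subst (m <_) eq m<) λ ()

  cells-unique : List.Unique (cells lam mu)
  cells-unique = concatMap-unique rowCells (Unique.upTo⁺ (length lam))
    (λ i → Unique.map⁺ (λ eq → +-cancelˡ-≡ (part mu i) _ _ (cong proj₂ eq)) (Unique.upTo⁺ (part lam i ∸ part mu i)))
    λ {i} {i′} c∈ c∈′ → trans (sym (fst i c∈)) (fst i′ c∈′)
    where
    fst : ∀ i {c} → c ∈ rowCells i → proj₁ c ≡ i
    fst i c∈ with ∈-map⁻ (λ d → i , part mu i + d) c∈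
    ... | _ , _ , refl = refl

  cell-skew : ∀ a → Skew (part mu) (part lam) (cell lam mu a)
  cell-skew a = ∈-cells⁻ (∈-lookup {xs = cells lam mu} a)

  cell-surjective : ∀ {c} → Skew (part mu) (part lam) c → ∃ λ a → cell lam mu a ≡ c
  cell-surjective sk = Any.index (∈-cells⁺ sk) , sym (Any.lookup-index (∈-cells⁺ sk))

-- Positions in words, and the word read off a filling.

-- Positions are plain numbers: the lengths of the words compared are equal only propositionally, or
-- one word is a prefix of the other, and `Fin` indices would have to be transported.
data At {A : Set} : List A → ℕ → A → Set where
  here  : ∀ {x xs} → At (x ∷ xs) 0 x
  there : ∀ {x y xs p} → At xs p x → At (y ∷ xs) (suc p) x

module _ {A : Set} where

  at-functional : ∀ {xs : List A} {p x y} → At xs p x → At xs p y → x ≡ y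
  at-functional here      here      = refl
  at-functional (there a) (there b) = at-functional a b

  at⇒∈ : ∀ {xs : List A} {p x} → At xs p x → x ∈ xs
  at⇒∈ here      = here refl
  at⇒∈ (there a) = there (at⇒∈ a)

  ∈⇒at : ∀ {xs : List A} {x} → x ∈ xs → ∃ λ p → At xs p x
  ∈⇒at (here refl) = 0 , here
  ∈⇒at (there x∈)  = let p , a = ∈⇒at x∈ in suc p , there a

  at⇒< : ∀ {xs : List A} {p x} → At xs p x → p < length xs
  at⇒< here      = s≤s z≤n
  at⇒< (there a) = s≤s (at⇒< a)

  at-unique : ∀ {xs : List A} {p q x} → List.Unique xs → At xs p x → At xs q x → p ≡ q
  at-unique _          here      here      = refl
  at-unique (x∉ ∷ _)   here      (there b) = contradiction refl (All.lookup x∉ (at⇒∈ b))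
  at-unique (x∉ ∷ _)   (there a) here      = contradiction refl (All.lookup x∉ (at⇒∈ a))
  at-unique (_ ∷ xs!)  (there a) (there b) = cong suc (at-unique xs! a b)

  at-allPairs : ∀ {R : A → A → Set} {xs p q x y} → AllPairs R xs → At xs p x → At xs q y → p < q → R x y
  at-allPairs (Rx ∷ _) here      (there b) _         = All.lookup Rx (at⇒∈ b)
  at-allPairs (_ ∷ Rs) (there a) (there b) (s≤s p<q) = at-allPairs Rs a b p<q

  allPairs-at : ∀ {R : A → A → Set} xs → (∀ {p q x y} → At xs p x → At xs q y → p < q → R x y) → AllPairs R xs
  allPairs-at []       _ = []
  allPairs-at (x ∷ xs) R =
    All.tabulate (λ y∈ → R here (there (proj₂ (∈⇒at y∈))) (s≤s z≤n)) ∷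
    allPairs-at xs λ a b p<q → R (there a) (there b) (s≤s p<q)

  at-++ : ∀ {xs ys : List A} {p x} → At xs p x → At (xs ++ ys) p x
  at-++ here      = here
  at-++ (there a) = there (at-++ a)

  at-++⁻ : ∀ xs {ys : List A} {p x} → p < length xs → At (xs ++ ys) p x → At xs p x
  at-++⁻ (x ∷ xs) _         here      = here
  at-++⁻ (x ∷ xs) (s≤s p<l) (there a) = there (at-++⁻ xs p<l a)

  at-prefix : ∀ (xs ys : List A) → (∀ {p x} → At xs p x → At ys p x) → ∃ λ zs → ys ≡ xs ++ zs
  at-prefix []       ys sub = ys , refl
  at-prefix (x ∷ xs) []       sub with () ← sub here
  at-prefix (x ∷ xs) (y ∷ ys) sub with sub here
  ... | here = let zs , eq = at-prefix xs ys (untail ∘ sub ∘ there) in zs , cong (x ∷_) eq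
    where
    untail : ∀ {y : A} {ys p z} → At (y ∷ ys) (suc p) z → At ys p z
    untail (there a) = a

  at-extensional : ∀ {xs ys : List A} → length xs ≡ length ys →
    (∀ {p x} → At xs p x → At ys p x) → xs ≡ ys
  at-extensional {xs} {ys} len sub with at-prefix xs ys sub
  ... | []     , refl = sym (++-identityʳ xs)
  ... | z ∷ zs , refl = contradiction
    (+-cancelˡ-≡ (length xs) 0 _ (trans (+-identityʳ _) (trans len (length-++ xs)))) λ ()

  at-lookup : ∀ (xs : List A) i → At xs (toℕ i) (List.lookup xs i)
  at-lookup (x ∷ xs) zero    = here
  at-lookup (x ∷ xs) (suc i) = there (at-lookup xs i)

  at-tabulate : ∀ {n} (F : Fin n → A) i → At (List.tabulate F) (toℕ i) (F i)
  at-tabulate F zero    = here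
  at-tabulate F (suc i) = there (at-tabulate (F ∘ suc) i)

-- If `v` were missed, `punchOut` at `v` would inject `suc n` points into `n`.
unique⇒surjective : ∀ {n} {U : Vec (Fin n) n} → Vec.Unique U → ∀ v → ∃ λ a → lookup U a ≡ v
unique⇒surjective {suc n} {U} U! v with Fin.any? (λ a → lookup U a Fin.≟ v)
... | yes found = found
... | no  none  = contradiction (Fin.injective⇒≤ {f = λ a → punchOut (v≢ a)} λ eq →
    VecUnique.lookup-injective U! _ _ (Fin.punchOut-injective (v≢ _) (v≢ _) eq)) 1+n≰n
  where
  v≢ : ∀ a → v ≢ lookup U a
  v≢ a eq = none (a , sym eq)

injective⇒unique : ∀ {A : Set} {n} {U : Vec A n} →
  (∀ {a b} → lookup U a ≡ lookup U b → a ≡ b) → Vec.Unique U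
injective⇒unique {U = U} inj = subst Vec.Unique (tabulate∘lookup U) (VecUnique.tabulate⁺ inj)

-- The word w lists the cells of U in the order of their entries.
record Reads (lam mu : List ℕ) (U : Filling lam mu) (w : List Cell) : Set where
  constructor reading
  field
    length≡ : length w ≡ size lam mu
    reads   : ∀ a → At w (toℕ (lookup U a)) (cell lam mu a)

open Reads

module _ {lam mu : List ℕ} where

  cell-injective : ∀ {a b} → cell lam mu a ≡ cell lam mu b → a ≡ b
  cell-injective {a} {b} eq = Fin.toℕ-injective (at-unique (cells-unique lam mu)
    (subst (At (cells lam mu) (toℕ a)) eq (at-lookup (cells lam mu) a)) (at-lookup (cells lam mu) b))

  reads-surjective : ∀ {U w} → Vec.Unique U → Reads lam mu U w → ∀ {p c} → At w p c →
    ∃ λ a → toℕ (lookup U a) ≡ p × cell lam mu a ≡ c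
  reads-surjective {U} {w} U! r {p} {c} at =
    let p<s   = subst (p <_) (length≡ r) (at⇒< at)
        a , U = unique⇒surjective U! (fromℕ< p<s)
        U′    = trans (cong toℕ U) (Fin.toℕ-fromℕ< p<s)
    in a , U′ , at-functional (subst (λ p → At w p (cell lam mu a)) U′ (reads r a)) at

  reads-exists : ∀ {U} → Vec.Unique U → ∃ (Reads lam mu U)
  reads-exists {U} U! = List.tabulate word , reading (length-tabulate word) λ a →
    subst (At (List.tabulate word) (toℕ (lookup U a)))
      (cong (cell lam mu) (VecUnique.lookup-injective U! _ _ (proj₂ (unique⇒surjective U! (lookup U a)))))
      (at-tabulate word (lookup U a))
    where
    -- The inverse permutation of `U`, followed by `cell`.
    word : Fin (size lam mu) → Cell
    word v = cell lam mu (proj₁ (unique⇒surjective U! v))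

  reads-functional : ∀ {U w w′} → Vec.Unique U → Reads lam mu U w → Reads lam mu U w′ → w ≡ w′
  reads-functional {U} {w} {w′} U! r r′ = at-extensional (trans (length≡ r) (sym (length≡ r′))) λ at →
    let a , U≡p , cell≡c = reads-surjective U! r at in subst₂ (At w′) U≡p cell≡c (reads r′ a)

  reads-injective : ∀ {U U′ w} → List.Unique w → Reads lam mu U w → Reads lam mu U′ w → U ≡ U′
  reads-injective {U} {U′} w! r r′ =
    lookup-extensional U U′ λ a → Fin.toℕ-injective (at-unique w! (reads r a) (reads r′ a))

  standard⇒tableau : ∀ {U w} → IsStandard lam mu U → Reads lam mu U w → Tableau (part mu) (part lam) w
  standard⇒tableau {U} {w} (U! , rows , columns) r = record
    { ordered  = allPairs-at w λ {p} {q} {c} {d} at at′ p<q d⊑c →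
        let a , U≡p , a≡c = reads-surjective U! r at
            b , U≡q , b≡d = reads-surjective U! r at′
        in <⇒≱ (subst₂ _<_ (sym U≡p) (sym U≡q) p<q) (monotone b a (subst₂ _⊑_ (sym b≡d) (sym a≡c) d⊑c))
    ; complete = λ sk → let a , a≡c = cell-surjective lam mu sk in subst (_∈ w) a≡c (at⇒∈ (reads r a))
    ; sound    = λ c∈ → let _ , at = ∈⇒at c∈
                            a , _ , a≡c = reads-surjective U! r at
                        in subst (Skew (part mu) (part lam)) a≡c (cell-skew lam mu a)
    }
    where
    same : ∀ b a → cell lam mu b ≡ cell lam mu a → toℕ (lookup U b) ≤ toℕ (lookup U a)
    same b a eq = ≤-reflexive (cong (toℕ ∘ lookup U) (cell-injective eq))
    monotone : ∀ b a → cell lam mu b ⊑ cell lam mu a → toℕ (lookup U b) ≤ toℕ (lookup U a)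
    monotone b a (inj₁ (row≡ , col≤)) with m≤n⇒m<n∨m≡n col≤
    ... | inj₁ col< = <⇒≤ (≤-pred (rows b a row≡ col<))
    ... | inj₂ col≡ = same b a (cong₂ _,_ row≡ col≡)
    monotone b a (inj₂ (col≡ , row≤)) with m≤n⇒m<n∨m≡n row≤
    ... | inj₁ row< = <⇒≤ (≤-pred (columns b a col≡ row<))
    ... | inj₂ row≡ = same b a (cong₂ _,_ row≡ col≡)

  tableau-length : ∀ {w} → Tableau (part mu) (part lam) w → length w ≡ size lam mu
  tableau-length tab = length-≡ _≡_ (unique tab) (cells-unique lam mu)
    (λ c∈ → _ , ∈-cells⁺ lam mu (sound tab c∈) , refl)
    (λ c∈ → _ , complete tab (∈-cells⁻ lam mu c∈) , refl)
    (λ _ _ eq eq′ → trans eq (sym eq′)) (λ _ eq eq′ → trans (sym eq) eq′)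

  -- The entry of a cell is its position in the word. Two comparable cells with entries in the wrong
  -- order would contradict `ordered`.
  tableau⇒standard : ∀ {w} → Tableau (part mu) (part lam) w → ∃ λ U → Reads lam mu U w × IsStandard lam mu U
  tableau⇒standard {w} tab = U , reading (tableau-length tab) at-cell , U! , rows , columns
    where
    position : ∀ a → ∃ λ v → At w (toℕ v) (cell lam mu a)
    position a =
      let p , at = ∈⇒at (complete tab (cell-skew lam mu a))
          p<s    = subst (p <_) (tableau-length tab) (at⇒< at)
      in fromℕ< p<s , subst (λ p → At w p _) (sym (Fin.toℕ-fromℕ< p<s)) at
    U,at-cell = skolem position
    U = proj₁ U,at-cell
    at-cell = proj₂ U,at-cell
    U! : Vec.Unique U
    U! = injective⇒unique λ {a} {b} eq → cell-injective
      (at-functional (at-cell a) (subst (λ v → At w (toℕ v) _) (sym eq) (at-cell b)))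
    monotone : ∀ a b → cell lam mu a ⊑ cell lam mu b → cell lam mu a ≢ cell lam mu b → entry U a < entry U b
    monotone a b a⊑b a≢b with <-cmp (toℕ (lookup U a)) (toℕ (lookup U b))
    ... | tri< lt _ _ = s≤s lt
    ... | tri≈ _ eq _ = contradiction (at-functional (at-cell a) (subst (λ p → At w p _) (sym eq) (at-cell b))) a≢b
    ... | tri> _ _ gt = contradiction a⊑b (at-allPairs (ordered tab) (at-cell b) (at-cell a) gt)
    rows : RowsIncrease lam mu U
    rows a b row≡ col< = monotone a b (inj₁ (row≡ , <⇒≤ col<)) λ eq → <⇒≢ col< (cong proj₂ eq)
    columns : ColumnsIncrease lam mu U
    columns a b col≡ row< = monotone a b (inj₂ (col≡ , <⇒≤ row<)) λ eq → <⇒≢ row< (cong proj₁ eq)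

-- Tableaux as walks

fillings-unique : ∀ lam mu → List.Unique (fillings lam mu)
fillings-unique lam mu = vectors-unique (size lam mu) (Unique.allFin⁺ (size lam mu))

partition-decreasing : ∀ {n lam} → IsPartition n lam → Decreasing (part lam)
partition-decreasing (linked , _) = part-decreasing linked

partition-length : ∀ {n lam} → IsPartition n lam → length lam ≤ n
partition-length (_ , lam+ , refl) = length≤sum lam+

partition-below : ∀ {n lam N} → IsPartition n lam → n ≤ N → Below N (part lam)
partition-below {lam = lam} lam⊢n n≤N = below-mono (≤-trans (partition-length lam⊢n) n≤N) (part-below lam)

partition-∑ : ∀ {n lam N} → IsPartition n lam → n ≤ N → ∑ N (part lam) ≡ n
partition-∑ {lam = lam} lam⊢n@(_ , _ , sum≡n) n≤N = trans (∑-part lam (≤-trans (partition-length lam⊢n) n≤N)) sum≡n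

-- If g r < g′ r, the cell `(r , g r)` lies in h/g and hence in the word, but not in h/g′. Thus the
-- word alone recovers the inner shape, and `tableau-outer` likewise recovers the outer one.
tableau-inner : ∀ {g g′ h w} → (∀ r → g r ≤ h r) → (∀ r → g′ r ≤ h r) →
  Tableau g h w → Tableau g′ h w → g ≗ g′
tableau-inner {h = h} {w} g≤h g′≤h tab tab′ r = ≤-antisym (inner g≤h tab′ tab) (inner g′≤h tab tab′)
  where
  inner : ∀ {g g′} → (∀ r → g′ r ≤ h r) → Tableau g h w → Tableau g′ h w → g′ r ≤ g r
  inner {g} g′≤h tab tab′ = ≮⇒≥ λ g<g′ → <⇒≱ g<g′
    (proj₁ (sound tab′ (complete tab {r , g r} (≤-refl , <-≤-trans g<g′ (g′≤h r)))))

tableau-outer : ∀ {g h h′ w} → (∀ r → g r ≤ h r) → (∀ r → g r ≤ h′ r) →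
  Tableau g h w → Tableau g h′ w → h ≗ h′
tableau-outer {g} {w = w} g≤h g≤h′ tab tab′ r = ≤-antisym (outer g≤h′ tab tab′) (outer g≤h tab′ tab)
  where
  outer : ∀ {h h′} → (∀ r → g r ≤ h′ r) → Tableau g h w → Tableau g h′ w → h r ≤ h′ r
  outer {h} {h′} g≤h′ tab tab′ = ≮⇒≥ λ h′<h → <-irrefl refl
    (proj₂ (sound tab′ (complete tab {r , h′ r} (g≤h′ r , h′<h))))

walk-end : ∀ {g h h′ w} → h ≗ h′ → Walk g w h → Walk g w h′
walk-end eq (done eq′)      = done λ r → trans (eq′ r) (eq r)
walk-end eq (step j≡ add w) = step j≡ add (walk-end eq w)

module SkewCount {k lam} (lam⊢k : IsPartition k lam) {N} (k≤N : k ≤ N) {j} (j≤k : j ≤ k) where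

  private
    lam↓ : Decreasing (part lam)
    lam↓ = partition-decreasing lam⊢k

    supp : Below N (part lam)
    supp = partition-below lam⊢k k≤N

  tableaux : ∀ mu → List (Filling lam mu)
  tableaux mu = guard (mu ⊆? lam) (filter (isStandard? lam mu) (fillings lam mu))

  length-tableaux : ∀ mu → length (tableaux mu) ≡ f lam mu
  length-tableaux mu = go (mu ⊆? lam)
    where
    go : ∀ {P : Set} (d : Dec P) {xs : List (Filling lam mu)} →
      length (guard d xs) ≡ (if does d then length xs else 0)
    go (yes _) = refl
    go (no  _) = refl

  ReadsΣ : Σ (List ℕ) (Filling lam) → List Cell → Set
  ReadsΣ (mu , U) = Reads lam mu U

  record IsMember (mu : List ℕ) (U : Filling lam mu) : Set where
    constructor member
    field
      partition : IsPartition j mu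
      inside    : ∀ r → part mu r ≤ part lam r
      standard  : IsStandard lam mu U

    tableau : ∀ {w} → Reads lam mu U w → Tableau (part mu) (part lam) w
    tableau = standard⇒tableau standard

  open IsMember

  ∈⇒member : ∀ {mu U} → (mu , U) ∈ Σ-list (partitions j) tableaux → IsMember mu U
  ∈⇒member {mu} p∈ =
    let mu∈ , U∈   = ∈-Σ-list⁻ {xs = partitions j} {ys = tableaux} p∈
        mu⊆ , U∈′ = ∈-guard⁻ (mu ⊆? lam) U∈
    in member (∈-partitions⁻ {j} mu∈) (⊆⇒part≤ mu lam mu⊆)
         (proj₂ (∈-filter⁻ (isStandard? lam mu) {xs = fillings lam mu} U∈′))

  member⇒∈ : ∀ {mu U} → IsMember mu U → (mu , U) ∈ Σ-list (partitions j) tableaux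
  member⇒∈ {mu} {U} U-mem = ∈-Σ-list⁺ {ys = tableaux} (∈-partitions⁺ (partition U-mem))
    (∈-guard⁺ (mu ⊆? lam) (part≤⇒⊆ {mu} {lam} (inside U-mem))
      (∈-filter⁺ (isStandard? lam mu) (∈-allVectors U) (standard U-mem)))

  to : ∀ {mu U} → IsMember mu U → ∃ λ w → w ∈ downWalks N (k ∸ j) (part lam) × Reads lam mu U w
  to {mu} {U} U-mem = w , downWalks-complete N (k ∸ j) w-length mu↓ walk supp , r
    where
    word : ∃ (Reads lam mu U)
    word = reads-exists (proj₁ (standard U-mem))
    w = proj₁ word
    r = proj₂ word
    mu↓ = partition-decreasing (partition U-mem)
    walk : Walk (part mu) w (part lam)
    walk = tableau⇒walk mu↓ lam↓ (inside U-mem) (tableau U-mem r)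
    w-length : length w ≡ k ∸ j
    w-length = trans (sym (m+n∸m≡n j (length w))) (cong (_∸ j) (trans
      (cong (_+ length w) (sym (partition-∑ (partition U-mem) (≤-trans j≤k k≤N))))
      (trans (sym (walk-weight walk supp)) (partition-∑ lam⊢k k≤N))))

  from : ∀ {w} → w ∈ downWalks N (k ∸ j) (part lam) → ∃ λ mu → ∃ λ U → IsMember mu U × Reads lam mu U w
  from {w} w∈ =
    let w-length , g , g↓ , walk = downWalks-sound N (k ∸ j) (part lam) lam↓ w∈
    in fromWalk w-length g↓ walk
    where
    fromWalk : ∀ {g} → length w ≡ k ∸ j → Decreasing g → Walk g w (part lam) →
      ∃ λ mu → ∃ λ U → IsMember mu U × Reads lam mu U w
    fromWalk {g} w-length g↓ walk =
      let U , r , U-std = tableau⇒standard (walk⇒tableau (partition-decreasing mu⊢j) walk′)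
      in mu , U , member mu⊢j (walk-≤ walk′) U-std , r
      where
      mu = fromShape N g
      g-supp : Below N g
      g-supp r N≤r = n≤0⇒n≡0 (subst (g r ≤_) (supp r N≤r) (walk-≤ walk r))
      -- A walk of k - j steps that ends in λ starts from k - (k - j) cells; by `j≤k` no subtraction
      -- is truncated.
      ∑g≡j : ∑ N g ≡ j
      ∑g≡j = trans (sym (m+n∸n≡m (∑ N g) (k ∸ j))) (trans (cong (_∸ (k ∸ j)) (trans
        (cong (∑ N g +_) (sym w-length)) (trans (sym (walk-weight walk supp)) (partition-∑ lam⊢k k≤N))))
        (m∸[m∸n]≡n j≤k))
      mu⊢j : IsPartition j mu
      mu⊢j = subst (λ j → IsPartition j mu) ∑g≡j (fromShape-partition N g g↓ g-supp)
      walk′ : Walk (part mu) w (part lam)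
      walk′ = walk-resp (sym ∘ part-fromShape N g g↓ g-supp) walk

  injective : ∀ {mu mu′ U U′ w} → IsMember mu U → IsMember mu′ U′ →
    Reads lam mu U w → Reads lam mu′ U′ w → _≡_ {A = Σ (List ℕ) (Filling lam)} (mu , U) (mu′ , U′)
  injective {mu} {mu′} {U} {U′} {w} U-mem U′-mem r r′ = same
    (part-injective (proj₁ (proj₂ (partition U-mem))) (proj₁ (proj₂ (partition U′-mem)))
      (tableau-inner (inside U-mem) (inside U′-mem) (tableau U-mem r) (tableau U′-mem r′))) r′
    where
    -- Stated for variable `mu′` and `U′`, because matching on the equality of shapes has to carry
    -- `U′` and its reading over to the shape `mu`.
    same : ∀ {mu′ U′} → mu ≡ mu′ → Reads lam mu′ U′ w → (mu , U) ≡ (mu′ , U′)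
    same refl r′ = cong (mu ,_) (reads-injective (unique (tableau U-mem r)) r r′)

  count-skew : sum (map (f lam) (partitions j)) ≡ downs N (k ∸ j) (part lam)
  count-skew = begin
    sum (map (f lam) (partitions j))
      ≡⟨ cong sum (map-cong length-tableaux (partitions j)) ⟨
    sum (map (λ mu → length (tableaux mu)) (partitions j))
      ≡⟨ Σ-list-length (partitions j) tableaux ⟨
    length (Σ-list (partitions j) tableaux)
      ≡⟨ length-≡ ReadsΣ
           (Σ-list-unique (partitions-unique j) λ mu →
             guard-unique (mu ⊆? lam) (Unique.filter⁺ (isStandard? lam mu) (fillings-unique lam mu)))
           (downWalks-unique N (k ∸ j) (part lam))
           (λ p∈ → to (∈⇒member p∈))
           (λ w∈ → let mu , U , U-mem , r = from w∈ in (mu , U) , member⇒∈ U-mem , r)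
           (λ p∈ p′∈ → injective (∈⇒member p∈) (∈⇒member p′∈))
           (λ p∈ → reads-functional (proj₁ (standard (∈⇒member p∈)))) ⟩
    length (downWalks N (k ∸ j) (part lam))
      ≡⟨ length-downWalks N (k ∸ j) (part lam) ⟩
    downs N (k ∸ j) (part lam) ∎
    where open ≡-Reasoning

module ExtensionCount {k lam} (lam⊢k : IsPartition k lam) (T : Filling lam []) (T-std : IsStandard lam [] T)
                      {n} (k≤n : k ≤ n) where

  private
    lam↓ : Decreasing (part lam)
    lam↓ = partition-decreasing lam⊢k

    wordT : ∃ (Reads lam [] T)
    wordT = reads-exists (proj₁ T-std)

    wT : List Cell
    wT = proj₁ wordT

    readsT : Reads lam [] T wT
    readsT = proj₂ wordT

    walkT : Walk (part []) wT (part lam)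
    walkT = tableau⇒walk (λ _ → z≤n) lam↓ (λ _ → z≤n) (standard⇒tableau T-std readsT)

    ∑0≡0 : ∀ {N} → ∑ N (part []) ≡ 0
    ∑0≡0 {N} = ∑-zero N _ λ _ → refl

    length-wT : length wT ≡ k
    length-wT = trans (cong (_+ length wT) (sym ∑0≡0))
      (trans (sym (walk-weight walkT (partition-below lam⊢k k≤n))) (partition-∑ lam⊢k k≤n))

  tableau? : ∀ nu → Decidable λ U → IsStandard nu [] U × Contains k lam nu T U
  tableau? nu U = isStandard? nu [] U ×-dec contains? k lam nu T U

  tableaux : ∀ nu → List (Filling nu [])
  tableaux nu = filter (tableau? nu) (fillings nu [])

  -- That `U` contains `T` means that the word of `U` begins with `wT`. Only the remainder, a walk
  -- upwards from the shape of `T`, is related to `U`.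
  ReadsΣ : Σ (List ℕ) (λ nu → Filling nu []) → List Cell → Set
  ReadsΣ (nu , U) w = Reads nu [] U (wT ++ w)

  record IsMember (nu : List ℕ) (U : Filling nu []) : Set where
    constructor member
    field
      partition : IsPartition n nu
      standard  : IsStandard nu [] U
      contains  : Contains k lam nu T U

    tableau : ∀ {w} → Reads nu [] U w → Tableau (part []) (part nu) w
    tableau = standard⇒tableau standard

  open IsMember

  ∈⇒member : ∀ {nu U} → (nu , U) ∈ Σ-list (partitions n) tableaux → IsMember nu U
  ∈⇒member {nu} p∈ =
    let nu∈ , U∈ = ∈-Σ-list⁻ {xs = partitions n} {ys = tableaux} p∈
        _ , U-std , U-con = ∈-filter⁻ (tableau? nu) {xs = fillings nu []} U∈
    in member (∈-partitions⁻ {n} nu∈) U-std U-con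

  member⇒∈ : ∀ {nu U} → IsMember nu U → (nu , U) ∈ Σ-list (partitions n) tableaux
  member⇒∈ {nu} {U} U-mem = ∈-Σ-list⁺ {ys = tableaux} (∈-partitions⁺ (partition U-mem))
    (∈-filter⁺ (tableau? nu) (∈-allVectors U) (standard U-mem , contains U-mem))

  to : ∀ {nu U} → IsMember nu U → ∃ λ w → w ∈ upWalks n (n ∸ k) (part lam) × Reads nu [] U (wT ++ w)
  to {nu} {U} U-mem = let w , v≡ = at-prefix wT v prefix in
    w , suffix w (subst (Reads nu [] U) v≡ r) , subst (Reads nu [] U) v≡ r
    where
    word : ∃ (Reads nu [] U)
    word = reads-exists (proj₁ (standard U-mem))
    v = proj₁ word
    r = proj₂ word
    prefix : ∀ {p c} → At wT p c → At v p c
    prefix at =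
      let a , T≡p , a≡c = reads-surjective (proj₁ T-std) readsT at
          b , b≡a , U≡T = proj₁ (contains U-mem) a
      in subst₂ (At v) (trans (suc-injective U≡T) T≡p) (trans b≡a a≡c) (reads r b)
    suffix : ∀ w → Reads nu [] U (wT ++ w) → w ∈ upWalks n (n ∸ k) (part lam)
    suffix w r = subst (λ m → w ∈ upWalks n m (part lam)) w-length (upWalks-complete n walk supp)
      where
      supp : Below n (part nu)
      supp = partition-below (partition U-mem) ≤-refl
      walk : Walk (part lam) w (part nu)
      walk = walk-drop walkT (tableau⇒walk (λ _ → z≤n) (partition-decreasing (partition U-mem)) (λ _ → z≤n)
        (tableau U-mem r))
      w-length : length w ≡ n ∸ k
      w-length = trans (sym (m+n∸m≡n k (length w))) (cong (_∸ k) (trans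
        (cong (_+ length w) (sym (partition-∑ lam⊢k k≤n)))
        (trans (sym (walk-weight walk supp)) (partition-∑ (partition U-mem) ≤-refl))))

  from : ∀ {w} → w ∈ upWalks n (n ∸ k) (part lam) → ∃ λ nu → ∃ λ U → IsMember nu U × Reads nu [] U (wT ++ w)
  from {w} w∈ =
    let w-length , h , walk = upWalks-sound n (n ∸ k) (part lam) w∈
    in fromWalk w-length walk
    where
    fromWalk : ∀ {h} → length w ≡ n ∸ k → Walk (part lam) w h →
      ∃ λ nu → ∃ λ U → IsMember nu U × Reads nu [] U (wT ++ w)
    fromWalk {h} w-length walk =
      let U , r , U-std = tableau⇒standard tab
      in nu , U , member nu⊢n U-std (T⊆U U-std r , U⊆T r) , r
      where
      h↓ : Decreasing h
      h↓ = walk-decreasing walk lam↓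
      h-supp : Below n h
      h-supp = below-mono (≤-reflexive (trans (cong (k +_) w-length) (m+[n∸m]≡n k≤n)))
        (walk-below walk (partition-below lam⊢k ≤-refl))
      nu = fromShape n h
      ∑h≡n : ∑ n h ≡ n
      ∑h≡n = trans (walk-weight walk h-supp) (trans (cong₂ _+_ (partition-∑ lam⊢k k≤n) w-length) (m+[n∸m]≡n k≤n))
      nu⊢n : IsPartition n nu
      nu⊢n = subst (λ n′ → IsPartition n′ nu) ∑h≡n (fromShape-partition n h h↓ h-supp)
      tab : Tableau (part []) (part nu) (wT ++ w)
      tab = walk⇒tableau (λ _ → z≤n) (walk-++ walkT (walk-end (sym ∘ part-fromShape n h h↓ h-supp) walk))
      T⊆U : ∀ {U} → IsStandard nu [] U → Reads nu [] U (wT ++ w) →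
        ∀ a → ∃ λ b → cell nu [] b ≡ cell lam [] a × entry U b ≡ entry T a
      T⊆U U-std r a =
        let b , U≡T , b≡a = reads-surjective (proj₁ U-std) r (at-++ (reads readsT a))
        in b , b≡a , cong suc U≡T
      U⊆T : ∀ {U} → Reads nu [] U (wT ++ w) →
        ∀ b → entry U b ≤ k → ∃ λ a → cell lam [] a ≡ cell nu [] b × entry T a ≡ entry U b
      U⊆T {U} r b U≤k =
        -- Entries count from 1, so `entry U b ≤ k` says that the position of `b` in the word is
        -- less than `length wT`.
        let a , T≡U , a≡b = reads-surjective (proj₁ T-std) readsT
                              (at-++⁻ wT (subst (entry U b ≤_) (sym length-wT) U≤k) (reads r b))
        in a , a≡b , cong suc T≡U

  injective : ∀ {nu nu′ U U′ w} → IsMember nu U → IsMember nu′ U′ →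
    Reads nu [] U (wT ++ w) → Reads nu′ [] U′ (wT ++ w) →
    _≡_ {A = Σ (List ℕ) λ nu → Filling nu []} (nu , U) (nu′ , U′)
  injective {nu} {nu′} {U} {U′} {w} U-mem U′-mem r r′ = same
    (part-injective (proj₁ (proj₂ (partition U-mem))) (proj₁ (proj₂ (partition U′-mem)))
      (tableau-outer (λ _ → z≤n) (λ _ → z≤n) (tableau U-mem r) (tableau U′-mem r′))) r′
    where
    same : ∀ {nu′ U′} → nu ≡ nu′ → Reads nu′ [] U′ (wT ++ w) → (nu , U) ≡ (nu′ , U′)
    same refl r′ = cong (nu ,_) (reads-injective (unique (tableau U-mem r)) r r′)

  count-extensions : extensions k n lam T ≡ ups n (n ∸ k) (part lam)
  count-extensions = begin
    extensions k n lam T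
      ≡⟨ Σ-list-length (partitions n) tableaux ⟨
    length (Σ-list (partitions n) tableaux)
      ≡⟨ length-≡ ReadsΣ
           (Σ-list-unique (partitions-unique n) λ nu → Unique.filter⁺ (tableau? nu) (fillings-unique nu []))
           (upWalks-unique n (n ∸ k) (part lam))
           (λ p∈ → to (∈⇒member p∈))
           (λ w∈ → let nu , U , U-mem , r = from w∈ in (nu , U) , member⇒∈ U-mem , r)
           (λ p∈ p′∈ → injective (∈⇒member p∈) (∈⇒member p′∈))
           (λ p∈ r r′ → ++-cancelˡ wT _ _
             (reads-functional (proj₁ (standard (∈⇒member p∈))) r r′)) ⟩
    length (upWalks n (n ∸ k) (part lam))
      ≡⟨ length-upWalks n (n ∸ k) (part lam) ⟩
    ups n (n ∸ k) (part lam) ∎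
    where open ≡-Reasoning

-- Assembling the formula.

downs-vanish : ∀ N i g → Decreasing g → Below N g → ∑ N g < i → downs N i g ≡ 0
downs-vanish N i g g↓ supp ∑g<i = trans (sym (length-downWalks N i g)) (empty (downWalks N i g) λ w∈ →
  let w-length , g′ , _ , walk = downWalks-sound N i g g↓ w∈
  in <⇒≱ ∑g<i (subst₂ _≤_ w-length (sym (walk-weight walk supp)) (m≤n+m _ (∑ N g′))))
  where
  empty : ∀ {A : Set} (xs : List A) → (∀ {x} → ¬ x ∈ xs) → length xs ≡ 0
  empty []       _  = refl
  empty (x ∷ xs) ∉xs = contradiction (here refl) ∉xs

sum-map-* : ∀ {A : Set} (F : A → ℕ) c (xs : List A) → sum (map (λ x → F x * c) xs) ≡ sum (map F xs) * c
sum-map-* F c []       = refl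
sum-map-* F c (x ∷ xs) = trans (cong (F x * c +_) (sum-map-* F c xs)) (sym (*-distribʳ-+ c (F x) _))

open ClosedForm t refl refl t-recurrence

mainTheorem15 : (k : ℕ) (lam : List ℕ) → IsPartition k lam →
    (T : Filling lam []) → IsStandard lam [] T →
    (n : ℕ) → k ≤ n →
    extensions k n lam T ≡
    sum (map (λ j →
    sum (map (λ mu → f lam mu * ((n ∸ k) C (k ∸ j)) * t (n + j ∸ 2 * k))
    (partitions j)))
    (upTo (suc k)))
mainTheorem15 k lam lam⊢k T T-std n k≤n = begin
  extensions k n lam T
    ≡⟨ ExtensionCount.count-extensions lam⊢k T T-std k≤n ⟩
  ups n m (part lam)
    -- The bound `n` on the rows suffices: λ has at most k rows, and n - k steps open at most n - k
    -- new ones.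
    ≡⟨ ups-closed n m (length lam) (part lam) bound lam↓ (part-below lam) ⟩
  ∑ (suc m) X
    -- The closed form runs over i ≤ n - k, the theorem over i ≤ k. Both sums extend to a common
    -- range, one because the binomial vanishes above n - k, the other because no more than k cells
    -- can be removed from λ.
    ≡⟨ ∑-extend (suc m) k X (λ i m<i → cong (λ x → x * t (m ∸ i) * d i) (k>n⇒nCk≡0 m<i)) ⟨
  ∑ (k + suc m) X
    ≡⟨ cong (λ r → ∑ r X) (trans (+-suc k m) (trans (cong suc (+-comm k m)) (sym (+-suc m k)))) ⟩
  ∑ (m + suc k) X
    ≡⟨ ∑-extend (suc k) m X (λ i k<i → trans (cong ((m C i) * t (m ∸ i) *_)
         (downs-vanish n i (part lam) lam↓ supp (subst (_< i) (sym (partition-∑ lam⊢k k≤n)) k<i)))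
         (*-zeroʳ ((m C i) * t (m ∸ i)))) ⟩
  ∑ (suc k) X
    ≡⟨ ∑-reverse k X ⟨
  ∑ (suc k) (λ j → X (k ∸ j))
    ≡⟨ ∑-cong< (suc k) (λ { j (s≤s j≤k) → sym (inner j j≤k) }) ⟩
  ∑ (suc k) (λ j → sum (map (λ mu → f lam mu * (m C (k ∸ j)) * t (n + j ∸ 2 * k)) (partitions j)))
    ≡⟨ sum-upTo (suc k) _ ⟨
  sum (map (λ j → sum (map (λ mu → f lam mu * (m C (k ∸ j)) * t (n + j ∸ 2 * k)) (partitions j))) (upTo (suc k))) ∎
  where
  open ≡-Reasoning
  m = n ∸ k
  d : ℕ → ℕ
  d i = downs n i (part lam)
  X : ℕ → ℕ
  X i = (m C i) * t (m ∸ i) * d i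
  lam↓ = partition-decreasing lam⊢k
  supp = partition-below lam⊢k k≤n
  bound : length lam + m ≤ n
  bound = ≤-trans (+-monoˡ-≤ m (partition-length lam⊢k)) (≤-reflexive (m+[n∸m]≡n k≤n))
  -- Valid for truncated subtraction without a case distinction: if n + j < 2k, both sides are 0,
  -- and the binomial beside `t` vanishes.
  t-index : ∀ j → j ≤ k → n + j ∸ 2 * k ≡ m ∸ (k ∸ j)
  t-index j j≤k = begin
    n + j ∸ (k + (k + 0))          ≡⟨ cong₂ (λ x y → x + j ∸ (k + y)) (sym (m+[n∸m]≡n k≤n)) (+-identityʳ k) ⟩
    k + m + j ∸ (k + k)            ≡⟨ cong (_∸ (k + k)) (+-assoc k m j) ⟩
    k + (m + j) ∸ (k + k)          ≡⟨ [m+n]∸[m+o]≡n∸o k (m + j) k ⟩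
    m + j ∸ k                      ≡⟨ cong₂ _∸_ (+-comm m j) (sym (m+[n∸m]≡n j≤k)) ⟩
    j + m ∸ (j + (k ∸ j))          ≡⟨ [m+n]∸[m+o]≡n∸o j m (k ∸ j) ⟩
    m ∸ (k ∸ j)                    ∎
  inner : ∀ j → j ≤ k →
    sum (map (λ mu → f lam mu * (m C (k ∸ j)) * t (n + j ∸ 2 * k)) (partitions j)) ≡ X (k ∸ j)
  inner j j≤k = begin
    sum (map (λ mu → f lam mu * (m C (k ∸ j)) * t (n + j ∸ 2 * k)) (partitions j))
      ≡⟨ cong sum (map-cong (λ mu → *-assoc (f lam mu) _ _) (partitions j)) ⟩
    sum (map (λ mu → f lam mu * ((m C (k ∸ j)) * t (n + j ∸ 2 * k))) (partitions j))
      ≡⟨ sum-map-* (f lam) _ (partitions j) ⟩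
    sum (map (f lam) (partitions j)) * ((m C (k ∸ j)) * t (n + j ∸ 2 * k))
      ≡⟨ cong₂ (λ x y → x * ((m C (k ∸ j)) * t y)) (SkewCount.count-skew lam⊢k k≤n j≤k) (t-index j j≤k) ⟩
    d (k ∸ j) * ((m C (k ∸ j)) * t (m ∸ (k ∸ j)))
      ≡⟨ *-comm (d (k ∸ j)) _ ⟩
    X (k ∸ j) ∎
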